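{- Let $k \geq 0$ and let $F$ be a $k$-edge graph with $\gamma(F) = 1$, i.e. $F$ has a vertex adjacent to all other vertices of $F$. Let $m \ge 0$ and let $G$ be a connected $m$-edge graph such that $(G,F)$ is not special, i.e. $G$ is not a copy of $F$, and it is not the case that $F$ is a copy of $P_3$ (equivalently $K_{1,2}$) and $G$ is a copy of the $6$-cycle $C_6$. Then \[\iota(G,F) \leq \left\lfloor \frac{m+1}{k+2} \right\rfloor.\] Moreover, equality holds if $G$ is an $(m,F)$-special graph.
   Context: All graphs are finite and simple. For a graph $G$ and $D \subseteq V(G)$, $N[D]$ denotes the closed neighbourhood $\bigcup_{v\in D} N[v]$ of $D$ in $G$, and $G - N[D]$ is the graph obtained by deleting the vertices of $N[D]$. A graph is an $F$-copy if it is isomorphic to $F$. A set $D \subseteq V(G)$ is an $F$-isolating set of $G$ if $G - N[D]$ contains no subgraph that is an $F$-copy; $\iota(G,F)$ is the size of a smallest $F$-isolating set of $G$. $\gamma(F)$ is the domination number of $F$. $P_3$ is the path on $3$ vertices and $C_6$ the cycle on $6$ vertices. $(m,F)$-special graph (for $F$ a connected $k$-edge graph, with $F \simeq K_1$ if $k=0$): write $m+1 = q(k+2)+r$ with integers $q \ge 0$ and $0 \le r \le k+1$. If $q = 0$, an $(m,F)$-special graph is any connected $m$-edge graph. If $q \geq 1$: take distinct vertices $v_1,\dots,v_q$ and copies $F_1,\dots,F_q$ of $F$ such that $V(F_1),\dots,V(F_q)$ and $\{v_1,\dots,v_q\}$ are pairwise disjoint; for each $i\in[q]$ pick $w_i \in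 V(F_i)$ and let $G_i$ be the graph with vertex set $\{v_i\}\cup V(F_i)$ and edge set $\{v_iw_i\}\cup E(F_i)$. Let $T$ be any tree with vertex set $\{v_1,\dots,v_q\}$, and let $T'$ be any connected $r$-edge graph with $V(T') \cap \bigcup_{i=1}^q V(G_i) = \{v_q\}$. Then the graph $G$ with $V(G) = V(T') \cup \bigcup_{i=1}^q V(G_i)$ and $E(G) = E(T)\cup E(T')\cup \bigcup_{i=1}^q E(G_i)$ is an $(m,F)$-special graph. (Every such graph is a connected $m$-edge graph.) -}

module Defs where

open import Data.Nat using (ℕ; suc; _+_; _*_; _≤_; z≤n; s≤s; ∣_-_∣) renaming (_≟_ to _≟ℕ_)
open import Data.Nat.Properties using (∣n-n∣≡0; ∣-∣-comm)
open import Data.Fin using (Fin; toℕ; fromℕ; _<?_; _≟_)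
open import Data.Fin.Subset using (Subset; _∈_; _∉_; _⊆_; _∪_; _─_; ⊤; ⁅_⁆; ⋃; ∣_∣; Nonempty)
open import Data.Fin.Subset.Properties using (∈⊤; _∈?_; x∈p∧x∉q⇒x∈p─q)
open import Data.Vec using (tabulate)
open import Data.List using (List; length; map; filter; cartesianProduct; allFin)
open import Data.Product using (∃; ∃-syntax; _×_; _,_; proj₁; map₂; swap)
open import Data.Sum using (_⊎_; [_,_])
import Data.Sum as Sum
open import Function using (_∘_; _↔_; _⇔_; Inverse; Injective)
open import Level using (0ℓ)
open import Relation.Binary using (Rel; Decidable; Symmetric)
open import Relation.Binary.Construct.Closure.ReflexiveTransitive using (Star)
open import Relation.Binary.PropositionalEquality using (_≡_; _≢_; refl; sym; trans)
open import Relation.Nullary using (¬_; ¬?; _×-dec_; _⊎-dec_; does)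

-- The vertex set is an arbitrary subset of the ambient set Fin n, so that
-- subgraphs, vertex deletions and unions of graphs live in the same ambient
-- set and are literally graphs on subsets of the same vertices.
record Graph (n : ℕ) : Set₁ where
  infix 4 _~_ _~?_
  field
    V        : Subset n
    _~_      : Rel (Fin n) 0ℓ
    _~?_     : Decidable _~_
    ~-sym    : Symmetric _~_
    ~-irrefl : ∀ {v} → ¬ (v ~ v)
    ~⇒∈V     : ∀ {u v} → u ~ v → u ∈ V

  Vertex : Set
  Vertex = ∃[ v ] v ∈ V

  -- Each edge uv is listed once, as the pair with u < v.
  edges : List (Fin n × Fin n)
  edges = filter (λ (u , v) → (u <? v) ×-dec (u ~? v))
                 (cartesianProduct (allFin n) (allFin n))

  size : ℕ
  size = length edges

open Graph public using (V; Vertex; size)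

module _ {n : ℕ} (G : Graph n) where
  open Graph G using (_~_; _~?_; ~-sym; ~-irrefl; ~⇒∈V)

  -- Meaningful for v ∈ V G only.
  closedNbhd : Fin n → Subset n
  closedNbhd v = ⁅ v ⁆ ∪ tabulate (λ u → does (v ~? u))

  closedNbhdSet : Subset n → Subset n
  closedNbhdSet D = ⋃ (map closedNbhd (filter (_∈? D) (allFin n)))

  delete : Subset n → Graph n
  delete X = record
    { V        = V G ─ X
    ; _~_      = λ u v → (u ~ v) × (u ∉ X) × (v ∉ X)
    ; _~?_     = λ u v → (u ~? v) ×-dec ¬? (u ∈? X) ×-dec ¬? (v ∈? X)
    ; ~-sym    = λ (u~v , u∉X , v∉X) → ~-sym u~v , v∉X , u∉X
    ; ~-irrefl = ~-irrefl ∘ proj₁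
    ; ~⇒∈V     = λ (u~v , u∉X , _) → x∈p∧x∉q⇒x∈p─q (~⇒∈V u~v) u∉X
    }

  Connected : Set
  Connected = Nonempty (V G) × (∀ u v → u ∈ V G → v ∈ V G → Star _~_ u v)

record _⊑_ {n} (H G : Graph n) : Set where
  private
    module H = Graph H
    module G = Graph G
  field
    V⊆ : H.V ⊆ G.V
    ~⊆ : ∀ {u v} → u H.~ v → u G.~ v

record _≅_ {a b} (F : Graph a) (G : Graph b) : Set where
  private
    module F = Graph F
    module G = Graph G
  field
    bijection : F.Vertex ↔ G.Vertex
  open Inverse bijection public using (to; from)
  field
    ~⇔~ : ∀ x y → (proj₁ x F.~ proj₁ y) ⇔ (proj₁ (to x) G.~ proj₁ (to y))

Contains : ∀ {a n} → Graph n → Graph a → Set₁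
Contains {n = n} G F = ∃[ H ] H ⊑ G × F ≅ H

IsMinimumSize : ∀ {n ℓ} → (Subset n → Set ℓ) → ℕ → Set ℓ
IsMinimumSize P i = (∃[ D ] P D × ∣ D ∣ ≡ i) × (∀ D → P D → i ≤ ∣ D ∣)

Dominating : ∀ {n} → Graph n → Subset n → Set
Dominating G D = D ⊆ V G × closedNbhdSet G D ≡ V G

DominationNumber : ∀ {n} → Graph n → ℕ → Set
DominationNumber G = IsMinimumSize (Dominating G)

Isolating : ∀ {a n} → Graph n → Graph a → Subset n → Set₁
Isolating G F D = D ⊆ V G × ¬ Contains (delete G (closedNbhdSet G D)) F

-- IsolationNumber G F i says ι(G,F) = i. It is a relation because no
-- F-isolating set exists when F has no vertices.
IsolationNumber : ∀ {a n} → Graph n → Graph a → ℕ → Set₁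
IsolationNumber G F = IsMinimumSize (Isolating G F)

path : ∀ n → Graph n
path n = record
  { V        = ⊤
  ; _~_      = λ i j → ∣ toℕ i - toℕ j ∣ ≡ 1
  ; _~?_     = λ i j → ∣ toℕ i - toℕ j ∣ ≟ℕ 1
  ; ~-sym    = λ {i} {j} → trans (∣-∣-comm (toℕ j) (toℕ i))
  ; ~-irrefl = λ {v} → 0≢1 ∘ trans (sym (∣n-n∣≡0 (toℕ v)))
  ; ~⇒∈V     = λ _ → ∈⊤
  }
  where
  0≢1 : 0 ≢ 1
  0≢1 ()

cycle : ∀ n → 3 ≤ n → Graph n
cycle n 3≤n = record
  { V        = ⊤
  ; _~_      = λ i j → Adj ∣ toℕ i - toℕ j ∣
  ; _~?_     = λ i j → (∣ toℕ i - toℕ j ∣ ≟ℕ 1) ⊎-dec (suc ∣ toℕ i - toℕ j ∣ ≟ℕ n)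
  ; ~-sym    = λ {i} {j} → Sum.map (trans (∣-∣-comm (toℕ j) (toℕ i)))
                                   (trans (suc-comm (toℕ j) (toℕ i)))
  ; ~-irrefl = λ {v} → irrefl (∣n-n∣≡0 (toℕ v))
  ; ~⇒∈V     = λ _ → ∈⊤
  }
  where
  -- Adjacency in terms of the distance d between the labels of two vertices.
  Adj : ℕ → Set
  Adj d = d ≡ 1 ⊎ suc d ≡ n

  suc-comm : ∀ x y → suc ∣ x - y ∣ ≡ suc ∣ y - x ∣
  suc-comm x y rewrite ∣-∣-comm x y = refl

  1≢n : ∀ {n} → 3 ≤ n → 1 ≢ n
  1≢n (s≤s ()) refl

  irrefl : ∀ {d} → d ≡ 0 → ¬ Adj d
  irrefl refl = [ (λ ()) , 1≢n 3≤n ]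

P₃ : Graph 3
P₃ = path 3

C₆ : Graph 6
C₆ = cycle 6 (s≤s (s≤s (s≤s z≤n)))

Tree : ∀ {n} → Graph n → Set₁
Tree G = Connected G × (∀ l (3≤l : 3 ≤ l) → ¬ Contains G (cycle l 3≤l))

SpecialPair : ∀ {a n} → Graph n → Graph a → Set
SpecialPair G F = (F ≅ G) ⊎ (P₃ ≅ F × C₆ ≅ G)

-- Here q = suc p; the vertex vᵢ is indexed by i : Fin q, and fromℕ p is the
-- last index. The graphs F i, G i, T, T′ are Fᵢ, Gᵢ, T, T′ and all lie in the
-- ambient vertex set of G.
record Assembled {a n} (F₀ : Graph a) (p r : ℕ) (G₀ : Graph n) : Set₁ where
  private
    q = suc p
  field
    v : Fin q → Fin n
    F : Fin q → Graph n
    w : Fin q → Fin n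
    G : Fin q → Graph n
    T : Graph n
    T′ : Graph n
  private
    module F i = Graph (F i)
    module G i = Graph (G i)
    module T = Graph T
    module T′ = Graph T′
    module G₀ = Graph G₀
  field
    v-injective : Injective _≡_ _≡_ v
    F-copy      : ∀ i → F₀ ≅ F i
    F-disjoint  : ∀ i j → i ≢ j → ∀ x → x ∈ F.V i → x ∉ F.V j
    v∉F         : ∀ i j → v i ∉ F.V j

    w∈F : ∀ i → w i ∈ F.V i
    V-G : ∀ i x → x ∈ G.V i ⇔ (x ≡ v i ⊎ x ∈ F.V i)
    E-G : ∀ i x y → G._~_ i x y ⇔
            ((x ≡ v i × y ≡ w i) ⊎ (x ≡ w i × y ≡ v i) ⊎ F._~_ i x y)

    T-tree : Tree T
    V-T    : ∀ x → x ∈ T.V ⇔ (∃[ i ] x ≡ v i)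

    T′-connected : Connected T′
    T′-size      : T′.size ≡ r
    V-T′∩V-G     : ∀ x → (x ∈ T′.V × ∃[ i ] x ∈ G.V i) ⇔ x ≡ v (fromℕ p)

    V-G₀ : ∀ x → x ∈ G₀.V ⇔ (x ∈ T′.V ⊎ ∃[ i ] x ∈ G.V i)
    E-G₀ : ∀ x y → (x G₀.~ y) ⇔ ((x T.~ y) ⊎ (x T′.~ y) ⊎ ∃[ i ] G._~_ i x y)

data SpecialGraph {a n} (m : ℕ) (F : Graph a) (G : Graph n) : Set₁ where
  q≡0 : ∀ {r} → m + 1 ≡ 0 * (size F + 2) + r → r ≤ size F + 1 →
        Connected G → size G ≡ m → SpecialGraph m F G
  q≥1 : ∀ {p r} → m + 1 ≡ suc p * (size F + 2) + r → r ≤ size F + 1 →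
        Assembled F p r G → SpecialGraph m F G

{-# OPTIONS --safe #-}
module Submission where

-- Let s = k + 2 and write e(S) for the number of edges of G[S]. By strong induction, every connected
-- G[S] is special or has an isolating set D with |D| s ≤ e(S) + 1; the latter is the bound.
-- A special G[S] misses it by one only, and once any one vertex of S is deleted, (|D| + 1) s ≤ e(S) + 2
-- is possible. Hence S is done if some S - x has a special component: put x into D.
--
-- Otherwise let v be the centre of a copy of F, put v into D, and solve the components of S - N[v].
-- A component is joined to N[v] by at least one edge, a special one by at least two (to distinct
-- vertices, by the above). The count falls short by at most one edge, so one spare edge suffices, and we
-- are done unless G[N[v]] has exactly k edges and all components are tight. If S = N[v], then G[S] ≅ F.
-- A tight component L that is not special hangs on a bridge xy with y in L and s | e(L) + 1. Putting y
-- into D and solving the components of L - y stays within the bound for L, and removes x as well.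
-- A tight special component L is joined by exactly two edges. Then S - L may be taken special too, vertices
-- of degree 3 exclude C₆, and two copies of F joined by two disjoint edges are isolated by an end of one
-- of these edges unless they form C₆.
--
-- For the lower bound, an isolating set of a special graph must meet each V(Gᵢ).

open import Defs
open import Data.Empty using () renaming (⊥ to Empty)
open import Data.Fin using (Fin; zero; suc; _<_; _<?_; _≟_; fromℕ)
open import Data.Fin.Patterns using (0F; 1F; 2F; 3F; 4F; 5F)
open import Data.Fin.Properties using (<-cmp; <-asym; ≤∧≢⇒<; any?; all?)
import Data.Fin.Properties as Fin
open import Data.Fin.Subset
  using (Subset; _∈_; _∉_; _⊆_; _⊂_; _∪_; _∩_; _─_; _-_; ⁅_⁆; ∣_∣; ⋃; ⊥; Nonempty; inside; outside)
open import Data.Fin.Subset.Properties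
open import Data.List using (List; []; _∷_; _++_; length; filter; cartesianProduct; allFin)
import Data.List as List
open import Data.List.Membership.Propositional using () renaming (_∈_ to _∈ᴸ_)
open import Data.List.Membership.Propositional.Properties
  using (∈-∃++; ∈-++⁺ˡ; ∈-++⁺ʳ; ∈-++⁻; ∈-filter⁺; ∈-filter⁻; ∈-cartesianProduct⁺; ∈-allFin; ∈-length)
open import Data.List.Properties using (length-++-sucʳ)
import Data.List.Relation.Unary.All as All
open import Data.List.Relation.Unary.AllPairs using ([]; _∷_)
open import Data.List.Relation.Unary.Any using (here; there)
open import Data.List.Relation.Unary.Unique.Propositional using (Unique)
import Data.List.Relation.Unary.Unique.Propositional.Properties as Unique
open import Data.Nat using (ℕ; zero; suc; z≤n; s≤s; s≤s⁻¹; _≤_; _+_; _*_)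
import Data.Nat as ℕ
open import Data.Nat.DivMod using (_/_; m*n/n≡m; /-monoˡ-≤; m<n*o⇒m/o<n)
open import Data.Nat.Induction using (Acc; acc; <-wellFounded)
open import Data.Nat.Properties hiding (_≟_; <-cmp; <-asym; ≤∧≢⇒<; _<?_; suc-injective)
open import Data.Nat.Tactic.RingSolver using (solve-∀)
open import Data.Product using (∃; ∃-syntax; ∃₂; _×_; _,_; proj₁; proj₂; map₂)
import Data.Product as Product
open import Data.Sum using (_⊎_; inj₁; inj₂; [_,_]′)
import Data.Sum as Sum
open import Data.Vec using (Vec; []; _∷_; lookup; tabulate; here; there)
open import Data.Vec.Properties using (lookup∘tabulate; lookup⇒[]=; []=⇒lookup)
open import Data.Vec.Properties.WithK using ([]=-irrelevant)
open import Function using (_∘_; id; mk⇔; mk↔ₛ′; Equivalence; Inverse)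
open import Function.Properties.Inverse using (↔-sym; ↔-trans)
open import Level using (Level; 0ℓ)
open import Relation.Binary using (Rel; Decidable; tri<; tri≈; tri>)
open import Relation.Binary.Construct.Closure.ReflexiveTransitive using (Star; ε; _◅_)
open import Relation.Binary.PropositionalEquality using (_≡_; _≢_; refl; sym; trans; cong; subst; subst₂)
open import Relation.Nullary using (¬_; ¬?; Dec; yes; no; does; map′; _×-dec_; _⊎-dec_; _→-dec_; contradiction)
import Relation.Nullary.Decidable as Dec
open import Relation.Nullary.Decidable using (dec-true; decidable-stable; from-yes)
import Relation.Unary as U

-- Counting edges

module _ {A : Set} {P Q R : A → Set} (P? : U.Decidable P) (Q? : U.Decidable Q) (R? : U.Decidable R) where

  length-filter-disjoint : (∀ {x} → P x → R x) → (∀ {x} → Q x → R x) → (∀ {x} → P x → ¬ Q x) →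
    ∀ xs → length (filter P? xs) + length (filter Q? xs) ≤ length (filter R? xs)
  length-filter-disjoint P⇒R Q⇒R P⇒¬Q [] = z≤n
  length-filter-disjoint P⇒R Q⇒R P⇒¬Q (x ∷ xs)
    with rec ← length-filter-disjoint P⇒R Q⇒R P⇒¬Q xs | P? x | Q? x | R? x
  ... | yes p | yes q | _     = contradiction q (P⇒¬Q p)
  ... | yes p | no _  | yes _ = s≤s rec
  ... | yes p | no _  | no ¬r = contradiction (P⇒R p) ¬r
  ... | no _  | yes q | yes _ = ≤-trans (≤-reflexive (+-suc _ _)) (s≤s rec)
  ... | no _  | yes q | no ¬r = contradiction (Q⇒R q) ¬r
  ... | no _  | no _  | yes _ = m≤n⇒m≤1+n rec
  ... | no _  | no _  | no _  = rec

  length-filter-cover : (∀ {x} → R x → P x ⊎ Q x) →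
    ∀ xs → length (filter R? xs) ≤ length (filter P? xs) + length (filter Q? xs)
  length-filter-cover R⇒P⊎Q [] = z≤n
  length-filter-cover R⇒P⊎Q (x ∷ xs)
    with rec ← length-filter-cover R⇒P⊎Q xs | P? x | Q? x | R? x
  ... | yes _ | yes _ | yes _ = s≤s (≤-trans (m≤n⇒m≤1+n rec) (≤-reflexive (sym (+-suc _ _))))
  ... | yes _ | no _  | yes _ = s≤s rec
  ... | no _  | yes _ | yes _ = ≤-trans (s≤s rec) (≤-reflexive (sym (+-suc _ _)))
  ... | no ¬p | no ¬q | yes r = contradiction (R⇒P⊎Q r) [ ¬p , ¬q ]′
  ... | yes _ | yes _ | no _  = m≤n⇒m≤1+n (≤-trans (m≤n⇒m≤1+n rec) (≤-reflexive (sym (+-suc _ _))))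
  ... | yes _ | no _  | no _  = m≤n⇒m≤1+n rec
  ... | no _  | yes _ | no _  = ≤-trans (m≤n⇒m≤1+n rec) (≤-reflexive (sym (+-suc _ _)))
  ... | no _  | no _  | no _  = rec

injection⇒length≤ : ∀ {A B : Set} (g : A → B) {xs : List A} (ys : List B) → Unique xs →
  (∀ {x} → x ∈ᴸ xs → g x ∈ᴸ ys) → (∀ {x y} → x ∈ᴸ xs → y ∈ᴸ xs → g x ≡ g y → x ≡ y) →
  length xs ≤ length ys
injection⇒length≤ g ys [] g∈ g-inj = z≤n
injection⇒length≤ g {x ∷ xs} ys (x∉xs ∷ xs!) g∈ g-inj with ∈-∃++ (g∈ (here refl))
... | as , bs , refl = ≤-trans
  (s≤s (injection⇒length≤ g (as ++ bs) xs! g∈′ (λ y∈ z∈ → g-inj (there y∈) (there z∈))))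
  (≤-reflexive (sym (length-++-sucʳ as (g x) bs)))
  where
  g∈′ : ∀ {y} → y ∈ᴸ xs → g y ∈ᴸ as ++ bs
  g∈′ y∈ with ∈-++⁻ as (g∈ (there y∈))
  ... | inj₁ ∈as         = ∈-++⁺ˡ ∈as
  ... | inj₂ (there ∈bs) = ∈-++⁺ʳ as ∈bs
  ... | inj₂ (here eq)   = contradiction (g-inj (here refl) (there y∈) (sym eq)) (All.lookup x∉xs y∈)

constant⇒length≤1 : ∀ {A : Set} {xs : List A} → Unique xs → (∀ {x y} → x ∈ᴸ xs → y ∈ᴸ xs → x ≡ y) →
  length xs ≤ 1
constant⇒length≤1 {xs = []}         xs!        const = z≤n
constant⇒length≤1 {xs = x ∷ []}     xs!        const = s≤s z≤n
constant⇒length≤1 {xs = x ∷ y ∷ xs} (x∉ ∷ xs!) const =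
  contradiction (const (here refl) (there (here refl))) (All.lookup x∉ (here refl))

pairs : ∀ n → List (Fin n × Fin n)
pairs n = cartesianProduct (allFin n) (allFin n)

pairs-unique : ∀ n → Unique (pairs n)
pairs-unique n = Unique.cartesianProduct⁺ (Unique.allFin⁺ n) (Unique.allFin⁺ n)

module _ {n : ℕ} where

  Ascending : Rel (Fin n) 0ℓ → Fin n × Fin n → Set
  Ascending Q (u , v) = u < v × Q u v

  ascending? : {Q : Rel (Fin n) 0ℓ} → Decidable Q → U.Decidable (Ascending Q)
  ascending? Q? (u , v) = (u <? v) ×-dec Q? u v

  -- With the adjacency of a graph for `Q` this unfolds to `size`, so comparisons of counts are
  -- comparisons of edge numbers.
  count : {Q : Rel (Fin n) 0ℓ} → Decidable Q → ℕ
  count Q? = length (filter (ascending? Q?) (pairs n))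

  module _ {P Q R : Rel (Fin n) 0ℓ} (P? : Decidable P) (Q? : Decidable Q) (R? : Decidable R) where

    count-disjoint : (∀ {u v} → P u v → R u v) → (∀ {u v} → Q u v → R u v) →
                     (∀ {u v} → P u v → ¬ Q u v) → count P? + count Q? ≤ count R?
    count-disjoint P⇒R Q⇒R P⇒¬Q = length-filter-disjoint (ascending? P?) (ascending? Q?) (ascending? R?)
      (λ (u<v , p) → u<v , P⇒R p) (λ (u<v , q) → u<v , Q⇒R q) (λ (_ , p) (_ , q) → P⇒¬Q p q) (pairs n)

    count-cover : (∀ {u v} → R u v → P u v ⊎ Q u v) → count R? ≤ count P? + count Q?
    count-cover R⇒P⊎Q = length-filter-cover (ascending? P?) (ascending? Q?) (ascending? R?)
      (λ (u<v , r) → [ (λ p → inj₁ (u<v , p)) , (λ q → inj₂ (u<v , q)) ]′ (R⇒P⊎Q r)) (pairs n)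

  Joins : Fin n → Fin n → Rel (Fin n) 0ℓ
  Joins x y u v = (u ≡ x × v ≡ y) ⊎ (u ≡ y × v ≡ x)

  joins? : ∀ x y → Decidable (Joins x y)
  joins? x y u v = ((u ≟ x) ×-dec (v ≟ y)) ⊎-dec ((u ≟ y) ×-dec (v ≟ x))

  ∈pairs : ∀ u v → (u , v) ∈ᴸ pairs n
  ∈pairs u v = ∈-cartesianProduct⁺ (∈-allFin u) (∈-allFin v)

  count-joins : ∀ {x y} → x ≢ y → count (joins? x y) ≡ 1
  count-joins {x} {y} x≢y = ≤-antisym
    (constant⇒length≤1 (Unique.filter⁺ (ascending? (joins? x y)) (pairs-unique n)) const)
    nonempty
    where
    joining : List (Fin n × Fin n)
    joining = filter (ascending? (joins? x y)) (pairs n)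
    const : ∀ {e e′} → e ∈ᴸ joining → e′ ∈ᴸ joining → e ≡ e′
    const e∈ e′∈ with ∈-filter⁻ (ascending? (joins? x y)) {xs = pairs n} e∈
                    | ∈-filter⁻ (ascending? (joins? x y)) {xs = pairs n} e′∈
    ... | _ , _   , inj₁ (refl , refl) | _ , _   , inj₁ (refl , refl) = refl
    ... | _ , _   , inj₂ (refl , refl) | _ , _   , inj₂ (refl , refl) = refl
    ... | _ , x<y , inj₁ (refl , refl) | _ , y<x , inj₂ (refl , refl) = contradiction y<x (<-asym x<y)
    ... | _ , y<x , inj₂ (refl , refl) | _ , x<y , inj₁ (refl , refl) = contradiction y<x (<-asym x<y)
    nonempty : 1 ≤ count (joins? x y)
    nonempty with <-cmp x y
    ... | tri< x<y _ _ = ∈-length (∈-filter⁺ (ascending? (joins? x y)) (∈pairs x y) (x<y , inj₁ (refl , refl)))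
    ... | tri≈ _ x≡y _ = contradiction x≡y x≢y
    ... | tri> _ _ y<x = ∈-length (∈-filter⁺ (ascending? (joins? x y)) (∈pairs y x) (y<x , inj₂ (refl , refl)))

  -- An edge is counted at the pair with the smaller label first, and it is not known whether that
  -- is (x, y) or (y, x); hence both orientations are asked for.
  count-extra : {P R : Rel (Fin n) 0ℓ} (P? : Decidable P) (R? : Decidable R) →
    (∀ {u v} → P u v → R u v) → ∀ {x y} → x ≢ y → R x y → R y x → ¬ P x y → ¬ P y x →
    count P? + 1 ≤ count R?
  count-extra {P} {R} P? R? P⇒R {x} {y} x≢y Rxy Ryx ¬Pxy ¬Pyx =
    subst (λ j → count P? + j ≤ count R?) (count-joins x≢y) (count-disjoint P? (joins? x y) R? P⇒R
      (λ { (inj₁ (refl , refl)) → Rxy ; (inj₂ (refl , refl)) → Ryx })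
      (λ { p (inj₁ (refl , refl)) → ¬Pxy p ; p (inj₂ (refl , refl)) → ¬Pyx p }))

-- A copy is kept as an injective homomorphism rather than as a subgraph, so that it can be
-- relocated or restricted by changing `P` alone. Values of `f` off `A.V` carry no meaning.
record Copy {a n} (A : Graph a) (G : Graph n) (P : Fin n → Set) : Set where
  private
    module A = Graph A
    module G = Graph G
  field
    f     : Fin a → Fin n
    f∈    : ∀ {i} → i ∈ A.V → P (f i)
    f-inj : ∀ {i j} → i ∈ A.V → j ∈ A.V → f i ≡ f j → i ≡ j
    f~    : ∀ {i j} → i A.~ j → f i G.~ f j

  Image : Fin n → Set
  Image u = ∃ λ i → i ∈ A.V × f i ≡ u

  image? : U.Decidable Image
  image? u = any? λ i → (i ∈? A.V) ×-dec (f i ≟ u)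

  ImageEdge : Rel (Fin n) 0ℓ
  ImageEdge u v = ∃₂ λ i j → i A.~ j × f i ≡ u × f j ≡ v

  imageEdge? : Decidable ImageEdge
  imageEdge? u v = any? λ i → any? λ j → (i A.~? j) ×-dec (f i ≟ u) ×-dec (f j ≟ v)

  -- `f` may reverse the order of labels, so an edge is sent to its sorted image. Two edges with the
  -- same image agree as unordered pairs, hence as ascending pairs.
  size≤imageEdges : size A ≤ count imageEdge?
  size≤imageEdges =
    injection⇒length≤ sorted _ (Unique.filter⁺ (ascending? A._~?_) (pairs-unique a)) sorted∈ sorted-inj
    where
    sorted : Fin a × Fin a → Fin n × Fin n
    sorted (i , j) with f i <? f j
    ... | yes _ = f i , f j
    ... | no  _ = f j , f i
    sorted∈ : ∀ {e} → e ∈ᴸ A.edges → sorted e ∈ᴸ filter (ascending? imageEdge?) (pairs n)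
    sorted∈ {i , j} e∈ with _ , _ , i~j ← ∈-filter⁻ (ascending? A._~?_) {xs = pairs a} e∈ with f i <? f j
    ... | yes fi<fj = ∈-filter⁺ (ascending? imageEdge?) (∈pairs _ _) (fi<fj , i , j , i~j , refl , refl)
    ... | no  fi≮fj = ∈-filter⁺ (ascending? imageEdge?) (∈pairs _ _)
      (≤∧≢⇒< (≮⇒≥ fi≮fj) (λ eq → G.~-irrefl (subst (λ z → z G.~ f j) (sym eq) (f~ i~j)))
      , j , i , A.~-sym i~j , refl , refl)
    sorted-inj : ∀ {e e′} → e ∈ᴸ A.edges → e′ ∈ᴸ A.edges → sorted e ≡ sorted e′ → e ≡ e′
    sorted-inj {i , j} {i′ , j′} e∈ e′∈ eq
      with _ , i<j , i~j ← ∈-filter⁻ (ascending? A._~?_) {xs = pairs a} e∈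
         | _ , i′<j′ , i′~j′ ← ∈-filter⁻ (ascending? A._~?_) {xs = pairs a} e′∈
      with i∈ ← A.~⇒∈V i~j | j∈ ← A.~⇒∈V (A.~-sym i~j) | i′∈ ← A.~⇒∈V i′~j′ | j′∈ ← A.~⇒∈V (A.~-sym i′~j′)
      with f i <? f j | f i′ <? f j′
    ... | yes _ | yes _ with refl ← f-inj i∈ i′∈ (cong proj₁ eq) | refl ← f-inj j∈ j′∈ (cong proj₂ eq) = refl
    ... | no _  | no _  with refl ← f-inj j∈ j′∈ (cong proj₁ eq) | refl ← f-inj i∈ i′∈ (cong proj₂ eq) = refl
    ... | yes _ | no _  with refl ← f-inj i∈ j′∈ (cong proj₁ eq) | refl ← f-inj j∈ i′∈ (cong proj₂ eq) =
      contradiction i<j (<-asym i′<j′)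
    ... | no _  | yes _ with refl ← f-inj j∈ i′∈ (cong proj₁ eq) | refl ← f-inj i∈ j′∈ (cong proj₂ eq) =
      contradiction i<j (<-asym i′<j′)

-- Copies and isomorphisms

∣p∪q∣≤∣p∣+∣q∣ : ∀ {m} (p q : Subset m) → ∣ p ∪ q ∣ ≤ ∣ p ∣ + ∣ q ∣
∣p∪q∣≤∣p∣+∣q∣ []            []            = z≤n
∣p∪q∣≤∣p∣+∣q∣ (inside ∷ p)  (inside ∷ q)  =
  s≤s (≤-trans (m≤n⇒m≤1+n (∣p∪q∣≤∣p∣+∣q∣ p q)) (≤-reflexive (sym (+-suc _ _))))
∣p∪q∣≤∣p∣+∣q∣ (inside ∷ p)  (outside ∷ q) = s≤s (∣p∪q∣≤∣p∣+∣q∣ p q)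
∣p∪q∣≤∣p∣+∣q∣ (outside ∷ p) (inside ∷ q)  = ≤-trans (s≤s (∣p∪q∣≤∣p∣+∣q∣ p q)) (≤-reflexive (sym (+-suc _ _)))
∣p∪q∣≤∣p∣+∣q∣ (outside ∷ p) (outside ∷ q) = ∣p∪q∣≤∣p∣+∣q∣ p q

∈─⇒∉ : ∀ {m} {x : Fin m} (p q : Subset m) → x ∈ p ─ q → x ∉ q
∈─⇒∉ (_ ∷ p) (outside ∷ q) (there x∈) (there x∈q) = ∈─⇒∉ p q x∈ x∈q
∈─⇒∉ (_ ∷ p) (inside ∷ q)  (there x∈) (there x∈q) = ∈─⇒∉ p q x∈ x∈q

∈─⁻ : ∀ {m} {x : Fin m} (p q : Subset m) → x ∈ p ─ q → x ∈ p × x ∉ q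
∈─⁻ p q x∈ = p─q⊆p p q x∈ , ∈─⇒∉ p q x∈

⁅x⁆⊆ : ∀ {n} {x : Fin n} {p : Subset n} → x ∈ p → ⁅ x ⁆ ⊆ p
⁅x⁆⊆ {x = x} {p} x∈p z∈ = subst (_∈ p) (sym (x∈⁅y⁆⇒x≡y x z∈)) x∈p

subsetOf : ∀ {n} {P : Fin n → Set} → U.Decidable P → Subset n
subsetOf P? = tabulate (does ∘ P?)

module _ {n} {P : Fin n → Set} (P? : U.Decidable P) {x : Fin n} where

  ∈subsetOf⁺ : P x → x ∈ subsetOf P?
  ∈subsetOf⁺ p = lookup⇒[]= x _ (trans (lookup∘tabulate _ x) (dec-true (P? x) p))

  ∈subsetOf⁻ : x ∈ subsetOf P? → P x
  ∈subsetOf⁻ x∈ with P? x | trans (sym (lookup∘tabulate (does ∘ P?) x)) ([]=⇒lookup x∈)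
  ... | yes p | _  = p
  ... | no _  | ()

anyVec? : ∀ {n a} {P : Vec (Fin n) a → Set} → U.Decidable P → Dec (∃ P)
anyVec? {a = zero}  P? = map′ ([] ,_) (λ { ([] , p) → p }) (P? [])
anyVec? {a = suc a} P? = map′ (λ (x , xs , p) → x ∷ xs , p) (λ { (x ∷ xs , p) → x , xs , p })
  (any? λ x → anyVec? λ xs → P? (x ∷ xs))

module _ {a n} {A : Graph a} {G : Graph n} where
  private
    module A = Graph A
    module G = Graph G

  copy-mono : {P Q : Fin n → Set} → (∀ {u} → P u → Q u) → Copy A G P → Copy A G Q
  copy-mono P⇒Q c = record { f = f ; f∈ = P⇒Q ∘ f∈ ; f-inj = f-inj ; f~ = f~ }
    where open Copy c

  -- Maps from `Fin a` are searched as vectors. A map and its table agree only pointwise, hence the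
  -- transport along `f≗`.
  copy? : {P : Fin n → Set} → U.Decidable P → Dec (Copy A G P)
  copy? {P} P? = map′ fromVec toVec (anyVec? λ xs → embeds? (lookup xs))
    where
    Embeds : (Fin a → Fin n) → Set
    Embeds f = (∀ i → i ∈ A.V → P (f i)) × (∀ i j → i ∈ A.V → j ∈ A.V → f i ≡ f j → i ≡ j)
             × (∀ i j → i A.~ j → f i G.~ f j)
    embeds? : ∀ f → Dec (Embeds f)
    embeds? f = all? (λ i → (i ∈? A.V) →-dec P? (f i))
          ×-dec all? (λ i → all? λ j → (i ∈? A.V) →-dec (j ∈? A.V) →-dec (f i ≟ f j) →-dec (i ≟ j))
          ×-dec all? (λ i → all? λ j → (i A.~? j) →-dec (f i G.~? f j))
    fromVec : ∃ (Embeds ∘ lookup) → Copy A G P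
    fromVec (xs , into , inj , hom) = record
      { f = lookup xs ; f∈ = into _ ; f-inj = inj _ _ ; f~ = hom _ _ }
    toVec : Copy A G P → ∃ (Embeds ∘ lookup)
    toVec c = tabulate f
      , (λ i i∈ → subst P (sym (f≗ i)) (f∈ i∈))
      , (λ i j i∈ j∈ eq → f-inj i∈ j∈ (trans (sym (f≗ i)) (trans eq (f≗ j))))
      , (λ i j i~j → subst₂ G._~_ (sym (f≗ i)) (sym (f≗ j)) (f~ i~j))
      where
      open Copy c
      f≗ : ∀ i → lookup (tabulate f) i ≡ f i
      f≗ = lookup∘tabulate f

vertex-≡ : ∀ {n} {G : Graph n} {x y : Vertex G} → proj₁ x ≡ proj₁ y → x ≡ y
vertex-≡ {x = _ , p} {_ , q} refl = cong (_ ,_) ([]=-irrelevant p q)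

module _ {a n} {A : Graph a} {B : Graph n} where
  private
    module A = Graph A
    module B = Graph B

  copy⇒≅ : (c : Copy A B (_∈ B.V)) → (∀ {z} → z ∈ B.V → Copy.Image c z) →
    (∀ {i j} → i ∈ A.V → j ∈ A.V → Copy.f c i B.~ Copy.f c j → i A.~ j) → A ≅ B
  copy⇒≅ c surj reflects = record
    { bijection = mk↔ₛ′ (λ (i , i∈) → f i , f∈ i∈) (λ (z , z∈) → let (i , i∈ , _) = surj z∈ in i , i∈)
                        (λ (z , z∈) → vertex-≡ {G = B} (proj₂ (proj₂ (surj z∈))))
                        (λ (i , i∈) → let (j , j∈ , eq) = surj (f∈ i∈) in vertex-≡ {G = A} (f-inj j∈ i∈ eq))
    ; ~⇔~ = λ (i , i∈) (j , j∈) → mk⇔ f~ (reflects i∈ j∈)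
    }
    where open Copy c

  ≅-injective : (iso : A ≅ B) → ∀ {x y} → proj₁ (_≅_.to iso x) ≡ proj₁ (_≅_.to iso y) → x ≡ y
  ≅-injective iso {x} {y} eq = trans (sym (Inverse.strictlyInverseʳ bijection x))
    (trans (cong from (vertex-≡ {G = B} eq)) (Inverse.strictlyInverseʳ bijection y))
    where open _≅_ iso

  ≅⇒copy : Vertex A → A ≅ B → Copy A B (_∈ B.V)
  ≅⇒copy x₀ iso = record
    { f = g
    ; f∈ = λ {i} i∈ → subst (_∈ B.V) (sym (g≡to i∈)) (proj₂ (to (i , i∈)))
    ; f-inj = λ i∈ j∈ eq → cong proj₁ (≅-injective iso (trans (sym (g≡to i∈)) (trans eq (g≡to j∈))))
    ; f~ = λ {i} {j} i~j → let i∈ = A.~⇒∈V i~j ; j∈ = A.~⇒∈V (A.~-sym i~j) in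
        subst₂ B._~_ (sym (g≡to i∈)) (sym (g≡to j∈)) (Equivalence.to (~⇔~ (i , i∈) (j , j∈)) i~j)
    }
    where
    open _≅_ iso
    g : Fin a → Fin n
    g i with i ∈? A.V
    ... | yes i∈ = proj₁ (to (i , i∈))
    -- A default value off `A.V`; supplying it is what `x₀` is for.
    ... | no _   = proj₁ (to x₀)
    g≡to : ∀ {i} (i∈ : i ∈ A.V) → g i ≡ proj₁ (to (i , i∈))
    g≡to {i} i∈ with i ∈? A.V
    ... | yes i∈′ = cong (λ p → proj₁ (to (i , p))) ([]=-irrelevant i∈′ i∈)
    ... | no i∉   = contradiction i∈ i∉

  ≅-sym : A ≅ B → B ≅ A
  ≅-sym iso = record
    { bijection = ↔-sym bijection
    ; ~⇔~ = λ x y → mk⇔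
        (λ x~y → Equivalence.from (~⇔~ (from x) (from y))
          (subst₂ B._~_ (sym (cong proj₁ (to∘from x))) (sym (cong proj₁ (to∘from y))) x~y))
        (λ fx~fy → subst₂ B._~_ (cong proj₁ (to∘from x)) (cong proj₁ (to∘from y))
          (Equivalence.to (~⇔~ (from x) (from y)) fx~fy))
    }
    where
    open _≅_ iso
    to∘from = Inverse.strictlyInverseˡ bijection

module _ {a n} {A : Graph a} {B : Graph n} where
  private
    module A = Graph A
    module B = Graph B

  -- The subgraph takes only the image edges, so it is isomorphic to `A` even if `B` has further
  -- edges between image vertices.
  copy⇒contains : Copy A B (_∈ B.V) → Contains B A
  copy⇒contains c =
    H , record { V⊆ = V⊆ ; ~⊆ = λ { (_ , _ , i~j , refl , refl) → f~ i~j } } , copy⇒≅ cH surj reflects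
    where
    open Copy c
    H : Graph n
    H = record
      { V = subsetOf image?
      ; _~_ = ImageEdge
      ; _~?_ = imageEdge?
      ; ~-sym = λ (i , j , i~j , fi≡u , fj≡v) → j , i , A.~-sym i~j , fj≡v , fi≡u
      ; ~-irrefl = λ { (i , j , i~j , refl , fj≡v) → B.~-irrefl (subst (f i B.~_) fj≡v (f~ i~j)) }
      ; ~⇒∈V = λ { (i , j , i~j , refl , _) → ∈subsetOf⁺ image? (i , A.~⇒∈V i~j , refl) }
      }
    V⊆ : V H ⊆ B.V
    V⊆ u∈ with i , i∈ , refl ← ∈subsetOf⁻ image? u∈ = f∈ i∈
    cH : Copy A H (_∈ V H)
    cH = record { f = f ; f∈ = λ i∈ → ∈subsetOf⁺ image? (_ , i∈ , refl) ; f-inj = f-inj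
                ; f~ = λ i~j → _ , _ , i~j , refl , refl }
    surj : ∀ {z} → z ∈ V H → ∃ λ i → i ∈ A.V × f i ≡ z
    surj z∈ = ∈subsetOf⁻ image? z∈
    reflects : ∀ {i j} → i ∈ A.V → j ∈ A.V → ImageEdge (f i) (f j) → i A.~ j
    reflects i∈ j∈ (i′ , j′ , i′~j′ , eqi , eqj) =
      subst₂ A._~_ (f-inj (A.~⇒∈V i′~j′) i∈ eqi) (f-inj (A.~⇒∈V (A.~-sym i′~j′)) j∈ eqj) i′~j′

≅-trans : ∀ {a b c} {A : Graph a} {B : Graph b} {C : Graph c} → A ≅ B → B ≅ C → A ≅ C
≅-trans A≅B B≅C = record
  { bijection = ↔-trans (_≅_.bijection A≅B) (_≅_.bijection B≅C)
  ; ~⇔~ = λ x y → mk⇔ (Equivalence.to (_≅_.~⇔~ B≅C _ _) ∘ Equivalence.to (_≅_.~⇔~ A≅B x y))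
                      (Equivalence.from (_≅_.~⇔~ A≅B x y) ∘ Equivalence.from (_≅_.~⇔~ B≅C _ _))
  }

contains⇒copy : ∀ {a n} {A : Graph a} {B : Graph n} → Vertex A → Contains B A → Copy A B (_∈ V B)
contains⇒copy x₀ (H , H⊑B , A≅H) = record { f = f ; f∈ = V⊆ ∘ f∈ ; f-inj = f-inj ; f~ = ~⊆ ∘ f~ }
  where
  open _⊑_ H⊑B
  open Copy (≅⇒copy x₀ A≅H)

count-mono : ∀ {n} {P R : Rel (Fin n) 0ℓ} (P? : Decidable P) (R? : Decidable R) →
  (∀ {u v} → P u v → R u v) → count P? ≤ count R?
count-mono P? R? P⇒R = m+n≤o⇒m≤o (count P?)
  (count-disjoint {Q = λ _ _ → Empty} P? (λ _ _ → no λ ()) R? P⇒R (λ ()) (λ _ ()))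

∈∪─ : ∀ {n} {z : Fin n} (S : Subset n) {T} → z ∈ S → z ∈ T ⊎ z ∈ S ─ T
∈∪─ {z = z} S {T} z∈S with z ∈? T
... | yes z∈T = inj₁ z∈T
... | no z∉T  = inj₂ (x∈p∧x∉q⇒x∈p─q z∈S z∉T)

-- Neighbourhoods, edge costs and components

module _ {n : ℕ} (G : Graph n) where
  open Graph G using (_~_; _~?_; ~-sym; ~-irrefl; ~⇒∈V)

  ~⇒≢ : ∀ {u v} → u ~ v → u ≢ v
  ~⇒≢ u~v refl = ~-irrefl u~v

  Near : Fin n → Fin n → Set
  Near x u = u ≡ x ⊎ x ~ u

  near? : Decidable Near
  near? x u = (u ≟ x) ⊎-dec (x ~? u)

  Dominated : Subset n → Fin n → Set
  Dominated D u = ∃ λ d → d ∈ D × Near d u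

  dominated? : ∀ D → U.Decidable (Dominated D)
  dominated? D u = any? λ d → (d ∈? D) ×-dec near? d u

  ∈closedNbhd⁺ : ∀ {x u} → Near x u → u ∈ closedNbhd G x
  ∈closedNbhd⁺ {x} (inj₁ refl) = x∈p∪q⁺ (inj₁ (x∈⁅x⁆ x))
  ∈closedNbhd⁺ {x} (inj₂ x~u)  = x∈p∪q⁺ (inj₂ (∈subsetOf⁺ (x ~?_) x~u))

  ∈closedNbhd⁻ : ∀ {x u} → u ∈ closedNbhd G x → Near x u
  ∈closedNbhd⁻ {x} u∈ with x∈p∪q⁻ ⁅ x ⁆ _ u∈
  ... | inj₁ u∈⁅x⁆ = inj₁ (x∈⁅y⁆⇒x≡y x u∈⁅x⁆)
  ... | inj₂ u∈N   = inj₂ (∈subsetOf⁻ (x ~?_) u∈N)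

  ∈closedNbhdSet⁺ : ∀ {D u} → Dominated D u → u ∈ closedNbhdSet G D
  ∈closedNbhdSet⁺ {D} {u} (d , d∈D , near) = go (∈-filter⁺ (_∈? D) (∈-allFin d) d∈D)
    where
    go : ∀ {ds} → d ∈ᴸ ds → u ∈ ⋃ (List.map (closedNbhd G) ds)
    go (here refl) = x∈p∪q⁺ (inj₁ (∈closedNbhd⁺ near))
    go (there d∈)  = x∈p∪q⁺ (inj₂ (go d∈))

  ∈closedNbhdSet⁻ : ∀ {D u} → u ∈ closedNbhdSet G D → Dominated D u
  ∈closedNbhdSet⁻ {D} {u} u∈ =
    let (d , d∈ , near) = go (filter (_∈? D) (allFin n)) u∈ in
    d , proj₂ (∈-filter⁻ (_∈? D) {xs = allFin n} d∈) , near
    where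
    go : ∀ ds → u ∈ ⋃ (List.map (closedNbhd G) ds) → ∃ λ d → d ∈ᴸ ds × Near d u
    go []       u∈ = contradiction u∈ ∉⊥
    go (d ∷ ds) u∈ with x∈p∪q⁻ (closedNbhd G d) _ u∈
    ... | inj₁ u∈N = d , here refl , ∈closedNbhd⁻ u∈N
    ... | inj₂ u∈⋃ with d′ , d′∈ , near ← go ds u∈⋃ = d′ , there d′∈ , near

  induced : Subset n → Graph n
  induced S = record
    { V        = S
    ; _~_      = λ u v → u ~ v × u ∈ S × v ∈ S
    ; _~?_     = λ u v → (u ~? v) ×-dec (u ∈? S) ×-dec (v ∈? S)
    ; ~-sym    = λ (u~v , u∈S , v∈S) → ~-sym u~v , v∈S , u∈S
    ; ~-irrefl = ~-irrefl ∘ proj₁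
    ; ~⇒∈V     = proj₁ ∘ proj₂
    }

  InducedEdge : Subset n → Rel (Fin n) 0ℓ
  InducedEdge S = Graph._~_ (induced S)

  inducedEdge? : ∀ S → Decidable (InducedEdge S)
  inducedEdge? S = Graph._~?_ (induced S)

  e : Subset n → ℕ
  e S = size (induced S)

  -- Once `Y` is dealt with, the edges with an end in the rest `R` are the budget for isolating `R`;
  -- edges to vertices outside both sets are left out.
  CostEdge : Subset n → Subset n → Rel (Fin n) 0ℓ
  CostEdge Y R u v = u ~ v × ((u ∈ R × v ∈ R) ⊎ (u ∈ R × v ∈ Y) ⊎ (u ∈ Y × v ∈ R))

  costEdge? : ∀ Y R → Decidable (CostEdge Y R)
  costEdge? Y R u v = (u ~? v) ×-dec
    (((u ∈? R) ×-dec (v ∈? R)) ⊎-dec ((u ∈? R) ×-dec (v ∈? Y)) ⊎-dec ((u ∈? Y) ×-dec (v ∈? R)))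

  cost : Subset n → Subset n → ℕ
  cost Y R = count (costEdge? Y R)

  Disjoint : Subset n → Subset n → Set
  Disjoint Y R = ∀ {u} → u ∈ Y → u ∉ R

  Closed : Subset n → Subset n → Set
  Closed L R = ∀ {u v} → u ∈ L → v ∈ R → u ~ v → v ∈ L

  Link : Subset n → Subset n → Fin n → Fin n → Set
  Link Y L x y = x ∈ Y × y ∈ L × x ~ y

  link? : ∀ Y L → Decidable (Link Y L)
  link? Y L x y = (x ∈? Y) ×-dec (y ∈? L) ×-dec (x ~? y)

  Distinct : (x y x′ y′ : Fin n) → Set
  Distinct x y x′ y′ = ¬ (x ≡ x′ × y ≡ y′)

  module _ {Y R : Subset n} (disj : Disjoint Y R) where

    e+cost≤e : ∀ {S} → Y ⊆ S → R ⊆ S → e Y + cost Y R ≤ e S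
    e+cost≤e {S} Y⊆S R⊆S = count-disjoint (inducedEdge? Y) (costEdge? Y R) (inducedEdge? S)
      (λ (u~v , u∈ , v∈) → u~v , Y⊆S u∈ , Y⊆S v∈)
      (λ { (u~v , inj₁ (u∈ , v∈))        → u~v , R⊆S u∈ , R⊆S v∈
         ; (u~v , inj₂ (inj₁ (u∈ , v∈))) → u~v , R⊆S u∈ , Y⊆S v∈
         ; (u~v , inj₂ (inj₂ (u∈ , v∈))) → u~v , Y⊆S u∈ , R⊆S v∈ })
      (λ { (_ , u∈Y , v∈Y) (_ , inj₁ (u∈ , v∈))        → disj u∈Y u∈
         ; (_ , u∈Y , v∈Y) (_ , inj₂ (inj₁ (u∈ , v∈))) → disj u∈Y u∈
         ; (_ , u∈Y , v∈Y) (_ , inj₂ (inj₂ (u∈ , v∈))) → disj v∈Y v∈ })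

    cost-split : ∀ {L} → L ⊆ R → cost Y L + cost Y (R ─ L) ≤ cost Y R
    cost-split {L} L⊆R = count-disjoint (costEdge? Y L) (costEdge? Y (R ─ L)) (costEdge? Y R)
      (map₂ (mono L⊆R)) (map₂ (mono (p─q⊆p R L)))
      (λ (_ , p) (_ , q) → disjoint p q)
      where
      Ends : Subset n → Fin n → Fin n → Set
      Ends R u v = (u ∈ R × v ∈ R) ⊎ (u ∈ R × v ∈ Y) ⊎ (u ∈ Y × v ∈ R)
      mono : ∀ {u v A B} → A ⊆ B → Ends A u v → Ends B u v
      mono A⊆B (inj₁ (u∈ , v∈))        = inj₁ (A⊆B u∈ , A⊆B v∈)
      mono A⊆B (inj₂ (inj₁ (u∈ , v∈))) = inj₂ (inj₁ (A⊆B u∈ , v∈))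
      mono A⊆B (inj₂ (inj₂ (u∈ , v∈))) = inj₂ (inj₂ (u∈ , A⊆B v∈))
      outsideL : ∀ {u} → u ∈ R ─ L → u ∉ L
      outsideL = ∈─⇒∉ R L
      disjoint : ∀ {u v} → Ends L u v → ¬ Ends (R ─ L) u v
      disjoint (inj₁ (u∈ , v∈))        (inj₁ (u∉ , v∉))        = outsideL u∉ u∈
      disjoint (inj₁ (u∈ , v∈))        (inj₂ (inj₁ (u∉ , v∉))) = outsideL u∉ u∈
      disjoint (inj₁ (u∈ , v∈))        (inj₂ (inj₂ (u∉ , v∉))) = outsideL v∉ v∈
      disjoint (inj₂ (inj₁ (u∈ , v∈))) (inj₁ (u∉ , v∉))        = outsideL u∉ u∈
      disjoint (inj₂ (inj₁ (u∈ , v∈))) (inj₂ (inj₁ (u∉ , v∉))) = outsideL u∉ u∈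
      disjoint (inj₂ (inj₁ (u∈ , v∈))) (inj₂ (inj₂ (u∉ , v∉))) = disj u∉ (L⊆R u∈)
      disjoint (inj₂ (inj₂ (u∈ , v∈))) (inj₁ (u∉ , v∉))        = outsideL v∉ v∈
      disjoint (inj₂ (inj₂ (u∈ , v∈))) (inj₂ (inj₁ (u∉ , v∉))) = disj v∉ (L⊆R v∈)
      disjoint (inj₂ (inj₂ (u∈ , v∈))) (inj₂ (inj₂ (u∉ , v∉))) = outsideL v∉ v∈

  module _ {Y L : Subset n} (disj : Disjoint Y L) where

    private
      1+ : {P : Rel (Fin n) 0ℓ} → Decidable P → Fin n → Fin n → ℕ
      1+ P? x y = count (λ u v → P? u v ⊎-dec joins? x y u v)

      add : {P : Rel (Fin n) 0ℓ} (P? : Decidable P) → ∀ {x y} → x ≢ y → ¬ P x y → ¬ P y x →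
            count P? + 1 ≤ 1+ P? x y
      add P? {x} {y} x≢y ¬Pxy ¬Pyx = count-extra P? (λ u v → P? u v ⊎-dec joins? x y u v) inj₁ x≢y
        (inj₂ (inj₁ (refl , refl))) (inj₂ (inj₂ (refl , refl))) ¬Pxy ¬Pyx

    private
      L⇒cost : ∀ {u v} → InducedEdge L u v → CostEdge Y L u v
      L⇒cost = map₂ inj₁

      joins⇒cost : ∀ {x y} → Link Y L x y → ∀ {u v} → Joins x y u v → CostEdge Y L u v
      joins⇒cost (x∈ , y∈ , x~y) (inj₁ (refl , refl)) = x~y , inj₂ (inj₂ (x∈ , y∈))
      joins⇒cost (x∈ , y∈ , x~y) (inj₂ (refl , refl)) = ~-sym x~y , inj₂ (inj₁ (y∈ , x∈))

      -- `Y` and `L` are disjoint, so each end of a link belongs to a known side, and two links can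
      -- join the same two vertices only in the same order.
      ¬joins : ∀ {x y x′ y′} → Link Y L x y → Link Y L x′ y′ → Distinct x y x′ y′ →
               ¬ Joins x y x′ y′ × ¬ Joins x y y′ x′
      ¬joins (x∈ , y∈ , _) (x′∈ , y′∈ , _) ≢ =
        (λ { (inj₁ (refl , refl)) → ≢ (refl , refl) ; (inj₂ (refl , refl)) → disj x′∈ y∈ }) ,
        (λ { (inj₁ (refl , refl)) → disj x∈ y′∈ ; (inj₂ (refl , refl)) → ≢ (refl , refl) })

    e+1≤cost : ∀ {x y} → Link Y L x y → e L + 1 ≤ cost Y L
    e+1≤cost l@(x∈ , y∈ , x~y) = count-extra (inducedEdge? L) (costEdge? Y L) L⇒cost (~⇒≢ x~y)
      (joins⇒cost l (inj₁ (refl , refl))) (joins⇒cost l (inj₂ (refl , refl)))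
      (λ (_ , x∈L , _) → disj x∈ x∈L) (λ (_ , _ , x∈L) → disj x∈ x∈L)

    e+2≤cost : ∀ {x y x′ y′} → Link Y L x y → Link Y L x′ y′ → Distinct x y x′ y′ → e L + 2 ≤ cost Y L
    e+2≤cost {x} {y} l@(x∈ , y∈ , x~y) l′@(x′∈ , y′∈ , x′~y′) ≢ =
      ≤-trans (≤-reflexive (sym (+-assoc (e L) 1 1))) (≤-trans
        (+-monoˡ-≤ 1 (add (inducedEdge? L) (~⇒≢ x~y) (λ (_ , x∈L , _) → disj x∈ x∈L) (λ (_ , _ , x∈L) → disj x∈ x∈L)))
        (count-extra _ (costEdge? Y L) [ L⇒cost , joins⇒cost l ]′ (~⇒≢ x′~y′)
          (joins⇒cost l′ (inj₁ (refl , refl))) (joins⇒cost l′ (inj₂ (refl , refl)))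
          [ (λ (_ , x∈L , _) → disj x′∈ x∈L) , proj₁ (¬joins l l′ ≢) ]′
          [ (λ (_ , _ , x∈L) → disj x′∈ x∈L) , proj₂ (¬joins l l′ ≢) ]′))

    e+3≤cost : ∀ {x y x′ y′ x″ y″} → Link Y L x y → Link Y L x′ y′ → Link Y L x″ y″ →
      Distinct x y x′ y′ → Distinct x y x″ y″ → Distinct x′ y′ x″ y″ → e L + 3 ≤ cost Y L
    e+3≤cost {x} {y} {x′} {y′} l@(x∈ , y∈ , x~y) l′@(x′∈ , y′∈ , x′~y′) l″@(x″∈ , y″∈ , x″~y″) ≢ ≢′ ≢″ =
      ≤-trans (≤-reflexive (trans (sym (+-assoc (e L) 1 2)) (sym (+-assoc (e L + 1) 1 1)))) (≤-trans
        (+-monoˡ-≤ 1 (≤-trans (+-monoˡ-≤ 1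
          (add (inducedEdge? L) (~⇒≢ x~y) (λ (_ , x∈L , _) → disj x∈ x∈L) λ (_ , _ , x∈L) → disj x∈ x∈L))
          (add _ (~⇒≢ x′~y′)
            [ (λ (_ , x∈L , _) → disj x′∈ x∈L) , proj₁ (¬joins l l′ ≢) ]′
            [ (λ (_ , _ , x∈L) → disj x′∈ x∈L) , proj₂ (¬joins l l′ ≢) ]′)))
        (count-extra _ (costEdge? Y L) [ [ L⇒cost , joins⇒cost l ]′ , joins⇒cost l′ ]′ (~⇒≢ x″~y″)
          (joins⇒cost l″ (inj₁ (refl , refl))) (joins⇒cost l″ (inj₂ (refl , refl)))
          [ [ (λ (_ , x∈L , _) → disj x″∈ x∈L) , proj₁ (¬joins l l″ ≢′) ]′ , proj₁ (¬joins l′ l″ ≢″) ]′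
          [ [ (λ (_ , _ , x∈L) → disj x″∈ x∈L) , proj₂ (¬joins l l″ ≢′) ]′ , proj₂ (¬joins l′ l″ ≢″) ]′))

  e+2≤e : ∀ {T S x y x′ y′} → T ⊆ S → InducedEdge S x y → ¬ InducedEdge T x y →
    InducedEdge S x′ y′ → ¬ InducedEdge T x′ y′ → ¬ Joins x y x′ y′ → e T + 2 ≤ e S
  e+2≤e {T} {S} {x} {y} {x′} {y′} T⊆S xy ¬xy x′y′ ¬x′y′ ¬same =
    ≤-trans (≤-reflexive (sym (+-assoc (e T) 1 1))) (≤-trans
      (+-monoˡ-≤ 1 (count-extra (inducedEdge? T) T∪xy? inj₁ (~⇒≢ (proj₁ xy))
        (inj₂ (inj₁ (refl , refl))) (inj₂ (inj₂ (refl , refl))) ¬xy (¬xy ∘ Graph.~-sym (induced T))))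
      (count-extra T∪xy? (inducedEdge? S) [ map₂ (λ (u∈ , v∈) → T⊆S u∈ , T⊆S v∈) , joins⇒edge ]′
        (~⇒≢ (proj₁ x′y′)) x′y′ (Graph.~-sym (induced S) x′y′)
        [ ¬x′y′ , ¬same ]′ [ ¬x′y′ ∘ Graph.~-sym (induced T) , ¬same ∘ flipped ]′))
    where
    T∪xy? : Decidable (λ u v → InducedEdge T u v ⊎ Joins x y u v)
    T∪xy? u v = inducedEdge? T u v ⊎-dec joins? x y u v
    joins⇒edge : ∀ {u v} → Joins x y u v → InducedEdge S u v
    joins⇒edge (inj₁ (refl , refl)) = xy
    joins⇒edge (inj₂ (refl , refl)) = Graph.~-sym (induced S) xy
    flipped : ∀ {u v} → Joins x y v u → Joins x y u v
    flipped (inj₁ (p , q)) = inj₂ (q , p)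
    flipped (inj₂ (p , q)) = inj₁ (q , p)

  -- Connectivity in its cut form: every proper nonempty part of S is left by an edge.
  record Conn (S : Subset n) : Set where
    field
      nonempty : Nonempty S
      boundary : ∀ T → T ⊆ S → Nonempty T → ∀ {z} → z ∈ S → z ∉ T →
                 ∃₂ λ u v → u ∈ T × v ∈ S × v ∉ T × u ~ v

  open Conn public

  conn-neighbour : ∀ {S x z} → Conn S → x ∈ S → z ∈ S → x ≢ z → ∃ λ w → w ∈ S × x ~ w
  conn-neighbour {x = x} S-conn x∈S z∈S x≢z
    with u , w , u∈ , w∈S , _ , u~w ← boundary S-conn ⁅ x ⁆ (⁅x⁆⊆ x∈S) (x , x∈⁅x⁆ x) z∈S
           (x≢z ∘ sym ∘ x∈⁅y⁆⇒x≡y x)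
    with refl ← x∈⁅y⁆⇒x≡y x u∈ = w , w∈S , u~w

  conn-singleton : ∀ z → Conn ⁅ z ⁆
  conn-singleton z = record
    { nonempty = z , x∈⁅x⁆ z
    ; boundary = λ { T T⊆ (t , t∈T) {w} w∈ w∉T →
        contradiction (subst (_∈ T) (trans (x∈⁅y⁆⇒x≡y z (T⊆ t∈T)) (sym (x∈⁅y⁆⇒x≡y z w∈))) t∈T) w∉T }
    }

  -- If `T` separates `u` from `w`, the edge `uw` leaves it. Otherwise `T` cuts `L` properly, and a
  -- boundary edge of `T ∩ L` serves.
  conn-extend : ∀ {L u w} → Conn L → u ∈ L → u ~ w → Conn (L ∪ ⁅ w ⁆)
  conn-extend {L} {u} {w} L-conn u∈L u~w = record { nonempty = u , inL u∈L ; boundary = bd }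
    where
    inL : L ⊆ L ∪ ⁅ w ⁆
    inL = p⊆p∪q ⁅ w ⁆
    w∈ : w ∈ L ∪ ⁅ w ⁆
    w∈ = x∈p∪q⁺ (inj₂ (x∈⁅x⁆ w))
    case-∈ : ∀ {t} → t ∈ L ∪ ⁅ w ⁆ → t ∈ L ⊎ t ≡ w
    case-∈ t∈ with x∈p∪q⁻ L _ t∈
    ... | inj₁ t∈L = inj₁ t∈L
    ... | inj₂ t∈w = inj₂ (x∈⁅y⁆⇒x≡y w t∈w)
    viaL : ∀ {T t z} → t ∈ T → t ∈ L → z ∈ L → z ∉ T →
           ∃₂ λ a b → a ∈ T × b ∈ L ∪ ⁅ w ⁆ × b ∉ T × a ~ b
    viaL {T} t∈T t∈L z∈L z∉T
      with a , b , a∈ , b∈L , b∉ , a~b ← boundary L-conn (T ∩ L) (p∩q⊆q T L)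
             (_ , x∈p∩q⁺ (t∈T , t∈L)) z∈L (z∉T ∘ p∩q⊆p T L)
      = a , b , p∩q⊆p T L a∈ , inL b∈L , (λ b∈T → b∉ (x∈p∩q⁺ (b∈T , b∈L))) , a~b
    bd : ∀ T → T ⊆ L ∪ ⁅ w ⁆ → Nonempty T → ∀ {z} → z ∈ L ∪ ⁅ w ⁆ → z ∉ T →
         ∃₂ λ a b → a ∈ T × b ∈ L ∪ ⁅ w ⁆ × b ∉ T × a ~ b
    bd T T⊆ (t , t∈T) {z} z∈ z∉T with w ∈? T | u ∈? T
    ... | yes w∈T | no u∉T  = w , u , w∈T , inL u∈L , u∉T , ~-sym u~w
    ... | no w∉T  | yes u∈T = u , w , u∈T , w∈ , w∉T , u~w
    ... | yes w∈T | yes u∈T with case-∈ z∈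
    ...   | inj₁ z∈L  = viaL u∈T u∈L z∈L z∉T
    ...   | inj₂ refl = contradiction w∈T z∉T
    bd T T⊆ (t , t∈T) {z} z∈ z∉T | no w∉T | no u∉T with case-∈ (T⊆ t∈T)
    ...   | inj₁ t∈L  = viaL t∈T t∈L u∈L u∉T
    ...   | inj₂ refl = contradiction t∈T w∉T

  record Component (R L : Subset n) : Set where
    field
      L⊆R    : L ⊆ R
      conn   : Conn L
      closed : Closed L R

  -- `L` is closed in `R`, so no edge leads from the rest of `R` into `L`, and removing `L` hides no
  -- neighbour of `L′`.
  component-─ : ∀ {R L L′} → Component R L → Component (R ─ L) L′ → Component R L′
  component-─ {R} {L} {L′} comp comp′ = record { L⊆R = p─q⊆p R L ∘ C′.L⊆R ; conn = C′.conn ; closed = closed′ }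
    where
    module C = Component comp
    module C′ = Component comp′
    closed′ : Closed L′ R
    closed′ {u} {v} u∈ v∈ u~v = C′.closed u∈ (x∈p∧x∉q⇒x∈p─q v∈ λ v∈L →
      ∈─⇒∉ R L (C′.L⊆R u∈) (C.closed v∈L (p─q⊆p R L (C′.L⊆R u∈)) (~-sym u~v))) u~v

  component : ∀ {R z} → z ∈ R → ∃ λ L → z ∈ L × Component R L
  component {R} {z} z∈R = grow ⁅ z ⁆ (x∈⁅x⁆ z) (⁅x⁆⊆ z∈R)
                               (conn-singleton z) (<-wellFounded _)
    where
    grow : ∀ L → z ∈ L → L ⊆ R → Conn L → Acc ℕ._<_ ∣ R ─ L ∣ → ∃ λ L → z ∈ L × Component R L
    grow L z∈L L⊆R L-conn (acc rec)
      with any? (λ u → any? (λ w → (u ∈? L) ×-dec (w ∈? R) ×-dec ¬? (w ∈? L) ×-dec (u ~? w)))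
    ... | no ¬leaves = L , z∈L , record { L⊆R = L⊆R ; conn = L-conn ; closed = λ {u} {w} u∈ w∈ u~w →
            decidable-stable (w ∈? L) λ w∉ → ¬leaves (u , w , u∈ , w∈ , w∉ , u~w) }
    ... | yes (u , w , u∈ , w∈ , w∉ , u~w) = grow (L ∪ ⁅ w ⁆) (p⊆p∪q _ z∈L)
            (λ x∈ → [ L⊆R , (⁅x⁆⊆ w∈) ]′ (x∈p∪q⁻ L _ x∈))
            (conn-extend L-conn u∈ u~w)
            (rec (p⊂q⇒∣p∣<∣q∣ (shrink , w , x∈p∧x∉q⇒x∈p─q w∈ w∉ ,
                   λ w∈′ → ∈─⇒∉ R _ w∈′ (q⊆p∪q L _ (x∈⁅x⁆ w)))))
      where
      shrink : R ─ (L ∪ ⁅ w ⁆) ⊆ R ─ L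
      shrink x∈ with x∈R , x∉ ← ∈─⁻ R (L ∪ ⁅ w ⁆) x∈ = x∈p∧x∉q⇒x∈p─q x∈R (x∉ ∘ p⊆p∪q _)

  -- A boundary edge that runs into `L` can be replaced by an edge to `v`. If `v` lies in `T`, the
  -- boundary edge is taken for the complement of `T` and rerouted in the same way.
  conn-complement : ∀ {S L v} → Conn S → L ⊆ S → v ∈ S → v ∉ L →
    (∀ {y w} → y ∈ L → w ∈ S → w ∉ L → y ~ w → v ~ w) → Conn (S ─ L)
  conn-complement {S} {L} {v} S-conn L⊆S v∈S v∉L leaves = record
    { nonempty = v , v∈ ; boundary = bd }
    where
    v∈ : v ∈ S ─ L
    v∈ = x∈p∧x∉q⇒x∈p─q v∈S v∉L
    bd : ∀ T → T ⊆ S ─ L → Nonempty T → ∀ {z} → z ∈ S ─ L → z ∉ T →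
         ∃₂ λ a b → a ∈ T × b ∈ S ─ L × b ∉ T × a ~ b
    bd T T⊆ T≠∅ {z} z∈ z∉T with v ∈? T
    ... | no v∉T
      with a , b , a∈T , b∈S , b∉T , a~b ← boundary S-conn T (p─q⊆p S L ∘ T⊆) T≠∅ (p─q⊆p S L z∈) z∉T
      with b ∈? L
    ...   | yes b∈L = a , v , a∈T , v∈ , v∉T ,
      ~-sym (leaves b∈L (p─q⊆p S L (T⊆ a∈T)) (∈─⇒∉ S L (T⊆ a∈T)) (~-sym a~b))
    ...   | no b∉L  = a , b , a∈T , x∈p∧x∉q⇒x∈p─q b∈S b∉L , b∉T , a~b
    bd T T⊆ T≠∅ {z} z∈ z∉T | yes v∈T
      with a , b , a∈ , b∈S , b∉ , a~b ← boundary S-conn (S ─ L ─ T) (p─q⊆p S L ∘ p─q⊆p (S ─ L) T)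
             (z , x∈p∧x∉q⇒x∈p─q z∈ z∉T) v∈S (λ v∈′ → ∈─⇒∉ (S ─ L) T v∈′ v∈T)
      with a∈M , a∉T ← ∈─⁻ (S ─ L) T a∈
      with b ∈? L
    ...   | yes b∈L = v , a , v∈T , a∈M , a∉T , leaves b∈L (p─q⊆p S L a∈M) (∈─⇒∉ S L a∈M) (~-sym a~b)
    ...   | no b∉L  with b ∈? T
    ...     | yes b∈T = b , a , b∈T , a∈M , a∉T , ~-sym a~b
    ...     | no b∉T  = contradiction (x∈p∧x∉q⇒x∈p─q (x∈p∧x∉q⇒x∈p─q b∈S b∉L) b∉T) b∉

-- Isomorphism checks and the 6-cycle

≅⇒size≤ : ∀ {a b} {A : Graph a} {B : Graph b} → Vertex A → A ≅ B → size A ≤ size B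
≅⇒size≤ {A = A} {B} x₀ A≅B = ≤-trans size≤imageEdges
  (count-mono imageEdge? (Graph._~?_ B) λ { (_ , _ , i~j , refl , refl) → f~ i~j })
  where open Copy (≅⇒copy x₀ A≅B)

opposite : Fin 6 → Fin 6
opposite 0F = 3F
opposite 1F = 4F
opposite 2F = 5F
opposite 3F = 0F
opposite 4F = 1F
opposite 5F = 2F

-- The closed neighbourhood of the antipode misses only `i` and the two neighbours of `i`, which are
-- not adjacent. Settled by enumeration.
C₆-opposite : ∀ i p q → Graph._~_ C₆ p q → p ≢ i → q ≢ i →
              Near C₆ (opposite i) p ⊎ Near C₆ (opposite i) q
C₆-opposite = from-yes (all? λ i → all? λ p → all? λ q →
  (Graph._~?_ C₆ p q) →-dec ¬? (p ≟ i) →-dec ¬? (q ≟ i) →-dec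
  (near? C₆ (opposite i) p ⊎-dec near? C₆ (opposite i) q))

module _ {a n : ℕ} (A : Graph a) (G : Graph n) (f : Fin a → Fin n) where
  private
    module A = Graph A
    module G = Graph G

  -- One case for each pair of labels settles injectivity and both directions of adjacency at once,
  -- so an explicit finite isomorphism reduces to a table.
  data Entry (i j : Fin a) : Set where
    equal     : i ≡ j → Entry i j
    adjacent : i A.~ j → f i G.~ f j → Entry i j
    apart    : ¬ i A.~ j → ¬ f i G.~ f j → f i ≢ f j → Entry i j

  entry-sym : ∀ {i j} → Entry i j → Entry j i
  entry-sym (equal eq)         = equal (sym eq)
  entry-sym (adjacent p q)    = adjacent (A.~-sym p) (G.~-sym q)
  entry-sym (apart ¬p ¬q neq) = apart (¬p ∘ A.~-sym) (¬q ∘ G.~-sym) (neq ∘ sym)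

  table⇒≅ : ∀ {S} → (∀ i → i ∈ A.V) → (∀ i → f i ∈ S) → (∀ {z} → z ∈ S → ∃ λ i → f i ≡ z) →
            (∀ i j → Entry i j) → A ≅ induced G S
  table⇒≅ {S} all∈ f∈ surj table = copy⇒≅
    (record { f = f ; f∈ = λ {i} _ → f∈ i ; f-inj = λ {i} {j} _ _ → inj (table i j)
            ; f~ = λ {i} {j} i~j → hom (table i j) i~j , f∈ i , f∈ j })
    (λ z∈ → let (i , eq) = surj z∈ in i , all∈ i , eq)
    (λ {i} {j} _ _ (fi~fj , _) → reflects (table i j) fi~fj)
    where
    inj : ∀ {i j} → Entry i j → f i ≡ f j → i ≡ j
    inj (equal eq)       _  = eq
    inj (adjacent _ q)  eq = contradiction eq (~⇒≢ G q)
    inj (apart _ _ neq) eq = contradiction eq neq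
    hom : ∀ {i j} → Entry i j → i A.~ j → f i G.~ f j
    hom (equal refl)    p = contradiction p A.~-irrefl
    hom (adjacent _ q) p = q
    hom (apart ¬p _ _) p = contradiction p ¬p
    reflects : ∀ {i j} → Entry i j → f i G.~ f j → i A.~ j
    reflects (equal refl)    q = contradiction q G.~-irrefl
    reflects (adjacent p _) q = p
    reflects (apart _ ¬q _) q = contradiction q ¬q

-- Arithmetic of the bounds

-- `2 + k` pays for a deleted vertex, `b` for a special component with `e′` edges, and `c` for the
-- other components; `cᴸ` and `d` are costs, `E` is the total.
cut-bound : ∀ {k b c d e′ cᴸ E} → b + (2 + k) ≤ e′ + 2 → e′ + 1 ≤ cᴸ → cᴸ + c ≤ d → d ≤ E →
            2 + k + (b + c) ≤ E + 1
cut-bound {k} {b} {c} {d} {e′} {cᴸ} {E} b≤ e≤c c≤d d≤E = begin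
  2 + k + (b + c)   ≡⟨ lhs k b c ⟩
  b + (2 + k) + c   ≤⟨ +-monoˡ-≤ c b≤ ⟩
  e′ + 2 + c        ≡⟨ mid e′ c ⟩
  e′ + 1 + c + 1    ≤⟨ +-monoˡ-≤ 1 (≤-trans (+-monoˡ-≤ c e≤c) (≤-trans c≤d d≤E)) ⟩
  E + 1             ∎
  where
  open ≤-Reasoning
  lhs : ∀ k b c → 2 + k + (b + c) ≡ b + (2 + k) + c
  lhs = solve-∀
  mid : ∀ e c → e + 2 + c ≡ e + 1 + c + 1
  mid = solve-∀

heavy-bound : ∀ {k c eʸ E} → k + 1 ≤ eʸ → eʸ + c ≤ E → 2 + k + c ≤ E + 1
heavy-bound {k} {c} {eʸ} {E} k≤ ≤E = begin
  2 + k + c     ≡⟨ lhs k c ⟩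
  k + 1 + c + 1 ≤⟨ +-monoˡ-≤ 1 (≤-trans (+-monoˡ-≤ c k≤) ≤E) ⟩
  E + 1         ∎
  where
  open ≤-Reasoning
  lhs : ∀ k c → 2 + k + c ≡ k + 1 + c + 1
  lhs = solve-∀

-- The `k` edges in a closed neighbourhood and the final `+ 1` pay all but one of `2 + k`. A
-- component whose cost exceeds `b` pays the last one.
spare-bound : ∀ {k b c d cᴸ eʸ E} → k ≤ eʸ → b + 1 ≤ cᴸ → cᴸ + c ≤ d → eʸ + d ≤ E → 2 + k + (b + c) ≤ E + 1
spare-bound {k} {b} {c} {d} {cᴸ} {eʸ} {E} k≤ b≤ c≤d ≤E = begin
  2 + k + (b + c)       ≡⟨ lhs k b c ⟩
  k + (b + 1 + c) + 1   ≤⟨ +-monoˡ-≤ 1 (+-mono-≤ k≤ (≤-trans (+-monoˡ-≤ c b≤) c≤d)) ⟩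
  eʸ + d + 1            ≤⟨ +-monoˡ-≤ 1 ≤E ⟩
  E + 1                 ∎
  where
  open ≤-Reasoning
  lhs : ∀ k b c → 2 + k + (b + c) ≡ k + (b + 1 + c) + 1
  lhs = solve-∀

slack : ∀ {k b e} → b + (2 + k) ≤ e + 2 → b ≤ e + 1
slack {k} {b} {e} b≤ = ≤-trans (+-cancelʳ-≤ 2 b e (≤-trans (+-monoʳ-≤ b (m≤m+n 2 k)) b≤)) (m≤m+n e 1)

C₆-two-neighbours : ∀ i → ∃₂ λ p q → p ≢ q × Graph._~_ C₆ i p × Graph._~_ C₆ i q
C₆-two-neighbours = from-yes (all? λ i → any? λ p → any? λ q →
  ¬? (p ≟ q) ×-dec (Graph._~?_ C₆ i p) ×-dec (Graph._~?_ C₆ i q))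

bridge-bound : ∀ {eᴸ eᴹ c E} → eᴸ + 1 ≤ c → eᴹ + c ≤ E → eᴸ + 1 + (eᴹ + 1) ≤ E + 1
bridge-bound {eᴸ} {eᴹ} {c} {E} ≤c ≤E = begin
  eᴸ + 1 + (eᴹ + 1)  ≡⟨ lhs eᴸ eᴹ ⟩
  eᴹ + (eᴸ + 1) + 1  ≤⟨ +-monoˡ-≤ 1 (≤-trans (+-monoʳ-≤ eᴹ ≤c) ≤E) ⟩
  E + 1              ∎
  where
  open ≤-Reasoning
  lhs : ∀ l m → l + 1 + (m + 1) ≡ m + (l + 1) + 1
  lhs = solve-∀

copy-bound : ∀ {k eᴸ eᴹ c E} → k ≤ eᴸ → eᴸ + 2 ≤ c → eᴹ + c ≤ E → 2 + k + (eᴹ + 1) ≤ E + 1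
copy-bound {k} {eᴸ} {eᴹ} {c} {E} k≤ ≤c ≤E = begin
  2 + k + (eᴹ + 1)   ≡⟨ lhs k eᴹ ⟩
  eᴹ + (k + 2) + 1   ≤⟨ +-monoˡ-≤ 1 (≤-trans (+-monoʳ-≤ eᴹ (≤-trans (+-monoˡ-≤ 2 k≤) ≤c)) ≤E) ⟩
  E + 1              ∎
  where
  open ≤-Reasoning
  lhs : ∀ k m → 2 + k + (m + 1) ≡ m + (k + 2) + 1
  lhs = solve-∀

-- From `e < d * suc s` follows `d′ * suc s < suc d * suc s`, hence `d′ ≤ d`.
round-down : ∀ {s e} d d′ → d′ * suc s ≤ suc s + e → d * suc s ≡ e + 1 → d′ * suc s ≤ e + 1
round-down {s} {e} d d′ d′≤ d≡ = ≤-trans (*-monoˡ-≤ (suc s) (s≤s⁻¹ (*-cancelʳ-< (suc s) d′ (suc d) (begin-strict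
  d′ * suc s        ≤⟨ d′≤ ⟩
  suc s + e         <⟨ +-monoʳ-< (suc s) (≤-reflexive (sym (trans d≡ (+-comm e 1)))) ⟩
  suc s + d * suc s ∎)))) (≤-reflexive d≡)
  where open ≤-Reasoning

-- The upper bound

module Isolation {a n : ℕ} (F : Graph a) (G : Graph n) {c₀ : Fin a} (c₀∈F : c₀ ∈ V F)
  (c₀-universal : ∀ {i} → i ∈ V F → Near F c₀ i) where

  open Graph G using (_~_; _~?_; ~-sym; ~-irrefl)

  -- The summand 2 comes first so that `s` reduces to a successor, the form that `round-down` and
  -- the final division need.
  k s : ℕ
  k = size F
  s = 2 + k

  FCopy : (Fin n → Set) → Set
  FCopy = Copy F G

  copy-edge : ∀ {P : Fin n → Set} (c : FCopy P) → ∀ {u v} → Copy.ImageEdge c u v → P u × P v × u ~ v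
  copy-edge c (i , j , i~j , refl , refl) =
    f∈ (Graph.~⇒∈V F i~j) , f∈ (Graph.~⇒∈V F (Graph.~-sym F i~j)) , f~ i~j
    where open Copy c

  k≤e : ∀ {T} → FCopy (_∈ T) → k ≤ e G T
  k≤e {T} c = ≤-trans size≤imageEdges (count-mono imageEdge? (inducedEdge? G T)
    λ im → let (u∈ , v∈ , u~v) = copy-edge c im in u~v , u∈ , v∈)
    where open Copy c

  k+1≤e : ∀ {T} (c : FCopy (_∈ T)) → ∀ {u v} → u ∈ T → v ∈ T → u ~ v → ¬ Copy.ImageEdge c u v → k + 1 ≤ e G T
  k+1≤e {T} c u∈ v∈ u~v ¬im = ≤-trans (+-monoˡ-≤ 1 size≤imageEdges)
    (count-extra imageEdge? (inducedEdge? G T)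
      (λ im → let (u∈ , v∈ , u~v) = copy-edge c im in u~v , u∈ , v∈)
      (~⇒≢ G u~v) (u~v , u∈ , v∈) (~-sym u~v , v∈ , u∈) ¬im
      (λ (i , j , i~j , fi , fj) → ¬im (j , i , Graph.~-sym F i~j , fj , fi)))
    where open Copy c

  -- The copy already uses up all `k` edges of G[L]; an edge leaving its image would be one more.
  copy-surjective : ∀ {L} → Conn G L → e G L ≤ k → (c : FCopy (_∈ L)) → ∀ {z} → z ∈ L → Copy.Image c z
  copy-surjective {L} L-conn e≤k c {z} z∈L with Copy.image? c z
  ... | yes im = im
  ... | no ¬im
    with u , v , u∈ , v∈L , v∉ , u~v ← boundary L-conn (subsetOf (Copy.image? c))
           (λ u∈ → let (i , i∈ , fi≡u) = ∈subsetOf⁻ (Copy.image? c) u∈ in subst (_∈ L) fi≡u (Copy.f∈ c i∈))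
           (_ , ∈subsetOf⁺ (Copy.image? c) (c₀ , c₀∈F , refl)) z∈L (¬im ∘ ∈subsetOf⁻ (Copy.image? c))
    with i , i∈ , refl ← ∈subsetOf⁻ (Copy.image? c) u∈ =
    contradiction (≤-trans (≤-trans (≤-reflexive (+-comm 1 k))
      (k+1≤e c (Copy.f∈ c i∈) v∈L u~v
        (λ (_ , j , i~j , _ , fj≡v) → v∉ (∈subsetOf⁺ (Copy.image? c)
          (j , Graph.~⇒∈V F (Graph.~-sym F i~j) , fj≡v))))) e≤k) (<-irrefl refl)

  -- Serves two ends: a vertex of `L` that violates `P` excludes copies, and a copy around its
  -- centre shows that the centre dominates `L`.
  copy-spans : ∀ {L} {P : Fin n → Set} → Conn G L → e G L ≤ k → FCopy P → (∀ {u} → P u → u ∈ L) →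
               ∀ {z} → z ∈ L → P z
  copy-spans {L} {P} L-conn e≤k c P⇒L z∈L
    with i , i∈ , refl ← copy-surjective L-conn e≤k (copy-mono P⇒L c) z∈L = Copy.f∈ c i∈

  tight-copy⇒≅ : ∀ {L} → Conn G L → e G L ≤ k → FCopy (_∈ L) → F ≅ induced G L
  tight-copy⇒≅ {L} L-conn e≤k c = copy⇒≅
    (record { f = f ; f∈ = f∈ ; f-inj = f-inj
            ; f~ = λ i~j → let (u∈ , v∈ , u~v) = copy-edge c (_ , _ , i~j , refl , refl) in u~v , u∈ , v∈ })
    (copy-surjective L-conn e≤k c) reflects
    where
    open Copy c
    reflects : ∀ {i j} → i ∈ V F → j ∈ V F → InducedEdge G L (f i) (f j) → Graph._~_ F i j
    reflects {i} {j} i∈ j∈ (u~v , u∈ , v∈) with imageEdge? (f i) (f j)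
    ... | yes (_ , _ , i~j , eqi , eqj) = subst₂ (Graph._~_ F) (f-inj (Graph.~⇒∈V F i~j) i∈ eqi)
                                            (f-inj (Graph.~⇒∈V F (Graph.~-sym F i~j)) j∈ eqj) i~j
    ... | no ¬im = contradiction (≤-trans (≤-trans (≤-reflexive (+-comm 1 k)) (k+1≤e c u∈ v∈ u~v ¬im)) e≤k)
                                 (<-irrefl refl)

  -- This is where the universal vertex of `F` enters: its image dominates the whole copy.
  centre : ∀ {P : Fin n → Set} → FCopy P → ∃ λ c → P c × FCopy (λ u → P u × Near G c u)
  centre c = f c₀ , f∈ c₀∈F , record
    { f = f ; f-inj = f-inj ; f~ = f~
    ; f∈ = λ i∈ → f∈ i∈ , Sum.map (cong f) f~ (c₀-universal i∈) }
    where open Copy c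

  -- Every vertex of a copy is equal or adjacent to its centre, and no edge leads across, so the
  -- whole copy is on the side of its centre.
  copy-split : ∀ {P : Fin n → Set} (A B : Fin n → Set) → FCopy P → (∀ {u} → P u → A u ⊎ B u) →
    (∀ {u v} → P u → P v → A u → B v → ¬ u ~ v) → FCopy (λ u → P u × A u) ⊎ FCopy (λ u → P u × B u)
  copy-split {P} A B cp cover sep with centre cp
  ... | c , Pc , cp′ with cover Pc
  ... | inj₁ Ac = inj₁ (copy-mono inA cp′)
    where
    inA : ∀ {u} → P u × Near G c u → P u × A u
    inA (Pu , inj₁ refl) = Pu , Ac
    inA (Pu , inj₂ c~u)  = Pu , [ id , (λ Bu → contradiction c~u (sep Pc Pu Ac Bu)) ]′ (cover Pu)
  ... | inj₂ Bc = inj₂ (copy-mono inB cp′)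
    where
    inB : ∀ {u} → P u × Near G c u → P u × B u
    inB (Pu , inj₁ refl) = Pu , Bc
    inB (Pu , inj₂ c~u)  = Pu , [ (λ Au → contradiction (~-sym c~u) (sep Pu Pc Au Bc)) , id ]′ (cover Pu)

  -- Isolating sets within an edge budget

  -- Domination is taken in `G`; between vertices of `R` it agrees with domination in G[R], so no
  -- induced graph has to be formed.
  Isolates : (Fin n → Set) → Subset n → Subset n → Set
  Isolates X R D = ¬ FCopy (λ u → u ∈ R × ¬ X u × ¬ Dominated G D u)

  -- X marks the vertices that are deleted because they are dominated from outside R.
  Sol : (Fin n → Set) → Subset n → ℕ → Set
  Sol X R b = ∃ λ D → D ⊆ R × Isolates X R D × ∣ D ∣ * s ≤ b

  Nowhere : Fin n → Set
  Nowhere _ = Empty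

  Good Bad : Subset n → Set
  Good S = Sol Nowhere S (e G S + 1)
  Bad S  = SpecialPair (induced G S) F

  sol-mono : ∀ {X X′ : Fin n → Set} {R b b′} → (∀ {u} → X u → X′ u) → b ≤ b′ → Sol X R b → Sol X′ R b′
  sol-mono X⇒X′ b≤b′ (D , D⊆R , iso , ≤b) =
    D , D⊆R , iso ∘ copy-mono (λ (u∈ , ¬X , ¬D) → u∈ , ¬X ∘ X⇒X′ , ¬D) , ≤-trans ≤b b≤b′

  dominated-mono : ∀ {D D′} → D ⊆ D′ → ∀ {u} → Dominated G D u → Dominated G D′ u
  dominated-mono D⊆D′ (d , d∈ , near) = d , D⊆D′ d∈ , near

  ∪-size : ∀ (D D′ : Subset n) {b b′} → ∣ D ∣ * s ≤ b → ∣ D′ ∣ * s ≤ b′ → ∣ D ∪ D′ ∣ * s ≤ b + b′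
  ∪-size D D′ ≤b ≤b′ = ≤-trans (*-monoˡ-≤ s (∣p∪q∣≤∣p∣+∣q∣ D D′))
    (≤-trans (≤-reflexive (*-distribʳ-+ s ∣ D ∣ ∣ D′ ∣)) (+-mono-≤ ≤b ≤b′))

  -- Every edge between `A` and `B` loses an end to `X`, so `copy-split` puts a surviving copy
  -- inside one of them.
  sol-∪ : ∀ {X : Fin n → Set} {A B R b b′} → A ⊆ R → B ⊆ R → (∀ {u} → u ∈ R → u ∈ A ⊎ u ∈ B) →
    (∀ {u v} → u ∈ A → v ∈ B → u ~ v → X u ⊎ X v) → Sol X A b → Sol X B b′ → Sol X R (b + b′)
  sol-∪ {X} {A} {B} {R} A⊆R B⊆R cover sep (D , D⊆A , isoA , ≤b) (D′ , D′⊆B , isoB , ≤b′) =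
    D ∪ D′ , (λ d∈ → [ A⊆R ∘ D⊆A , B⊆R ∘ D′⊆B ]′ (x∈p∪q⁻ D D′ d∈)) , isolates , ∪-size D D′ ≤b ≤b′
    where
    isolates : Isolates X R (D ∪ D′)
    isolates cp with copy-split (_∈ A) (_∈ B) cp (cover ∘ proj₁)
      (λ (_ , ¬Xu , _) (_ , ¬Xv , _) u∈A v∈B u~v → [ ¬Xu , ¬Xv ]′ (sep u∈A v∈B u~v))
    ... | inj₁ cpA = isoA (copy-mono
       (λ ((_ , ¬X , ¬D) , u∈A) → u∈A , ¬X , ¬D ∘ dominated-mono (p⊆p∪q D′)) cpA)
    ... | inj₂ cpB = isoB (copy-mono
       (λ ((_ , ¬X , ¬D) , u∈B) → u∈B , ¬X , ¬D ∘ dominated-mono (q⊆p∪q D D′)) cpB)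

  -- Remembers that `x` is chosen, because at a bridge it must also dominate a vertex outside `S`.
  HubSol : Fin n → Subset n → ℕ → Set
  HubSol x S b = ∃ λ D → x ∈ D × D ⊆ S × Isolates Nowhere S D × ∣ D ∣ * s ≤ b

  hubSol⇒sol : ∀ {x S b} → HubSol x S b → Sol Nowhere S b
  hubSol⇒sol (D , _ , rest) = D , rest

  -- Choosing `x` costs `s` and deletes its closed neighbourhood, so the set for `R` may treat the
  -- vertices near `x` as gone.
  add-hub : ∀ {x S R b} → x ∈ S → R ⊆ S → (∀ {u} → u ∈ S → Near G x u ⊎ u ∈ R) →
            Sol (Near G x) R b → HubSol x S (s + b)
  add-hub {x} {S} {R} x∈S R⊆S cover (D , D⊆R , iso , ≤b) =
    ⁅ x ⁆ ∪ D , x∈D′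
    , (λ d∈ → [ (⁅x⁆⊆ x∈S) , R⊆S ∘ D⊆R ]′ (x∈p∪q⁻ ⁅ x ⁆ D d∈))
    , (λ cp → iso (copy-mono (λ {u} (u∈S , _ , ¬D) →
        let ¬near = λ near → ¬D (x , x∈D′ , near) in
        [ (λ near → contradiction near ¬near) , id ]′ (cover u∈S)
        , ¬near , ¬D ∘ dominated-mono (q⊆p∪q ⁅ x ⁆ D)) cp))
    , ∪-size ⁅ x ⁆ D (≤-reflexive (trans (cong (_* s) (∣⁅x⁆∣≡1 x)) (*-identityˡ s))) ≤b
    where
    x∈D′ : x ∈ ⁅ x ⁆ ∪ D
    x∈D′ = x∈p∪q⁺ (inj₁ (x∈⁅x⁆ x))

  ≅⇒copy-in : ∀ {L} → F ≅ induced G L → FCopy (_∈ L)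
  ≅⇒copy-in F≅L = record { f = f ; f∈ = f∈ ; f-inj = f-inj ; f~ = proj₁ ∘ f~ }
    where open Copy (≅⇒copy (c₀ , c₀∈F) F≅L)

  ≅⇒e≤k : ∀ {L} → F ≅ induced G L → e G L ≤ k
  ≅⇒e≤k F≅L = ≅⇒size≤ (_≅_.to F≅L (c₀ , c₀∈F)) (≅-sym F≅L)

  sol-∅ : ∀ {X : Fin n → Set} {R} → ¬ FCopy (λ u → u ∈ R × ¬ X u) → Sol X R 0
  sol-∅ ¬cp = ⊥ , (λ d∈ → contradiction d∈ ∉⊥) , ¬cp ∘ copy-mono (λ (u∈ , ¬X , _) → u∈ , ¬X)
    , ≤-reflexive (cong (_* s) (∣⊥∣≡0 n))

  P₃≅F⇒k≤2 : P₃ ≅ F → k ≤ 2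
  P₃≅F⇒k≤2 P₃≅F = ≅⇒size≤ (c₀ , c₀∈F) (≅-sym P₃≅F)

  -- A copy of `F` minus a vertex contains no copy of `F`, since a copy would have to span `L`; so
  -- nothing is chosen. In a 6-cycle minus a vertex the antipode alone meets every edge with its
  -- closed neighbourhood.
  bad-hit : ∀ {L y} → Conn G L → Bad L → y ∈ L → ∃ λ b → b + s ≤ e G L + 2 × Sol (_≡ y) L b
  bad-hit L-conn (inj₁ F≅L) y∈L =
    0 , ≤-trans (≤-reflexive (+-comm 2 k)) (+-monoˡ-≤ 2 (k≤e (≅⇒copy-in F≅L)))
      , sol-∅ (λ cp → proj₂ (copy-spans L-conn (≅⇒e≤k F≅L) cp proj₁ y∈L) refl)
  bad-hit {L} {y} L-conn (inj₂ (P₃≅F , C₆≅L)) y∈L =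
    -- Here `k ≤ 2`, so `s + s ≤ 8`, while the six edges give e(L) + 2 ≥ 8.
    1 * s , ≤-trans (+-mono-≤ (+-mono-≤ s≤4 (z≤n {0})) s≤4) (+-monoˡ-≤ 2 (≅⇒size≤ {A = C₆} (0F , ∈⊤) C₆≅L))
    , ⁅ z ⁆ , (⁅x⁆⊆ (proj₂ (to (opposite i , ∈⊤))))
    , noCopy , ≤-reflexive (cong (_* s) (∣⁅x⁆∣≡1 z))
    where
    open _≅_ C₆≅L
    s≤4 : s ≤ 4
    s≤4 = +-monoʳ-≤ 2 (P₃≅F⇒k≤2 P₃≅F)
    i : Fin 6
    i = proj₁ (from (y , y∈L))
    z : Fin n
    z = proj₁ (to (opposite i , ∈⊤))
    noCopy : Isolates (_≡ y) L ⁅ z ⁆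
    -- One edge of the copy of `P₃` is enough: it avoids `y`, so one of its ends is dominated by the
    -- antipode.
    noCopy cp =
      let (u∈ , u≢y , ¬Du) = f∈ (proj₂ (P.to (0F , ∈⊤)))
          (v∈ , v≢y , ¬Dv) = f∈ (proj₂ (P.to (1F , ∈⊤)))
      in
      [ ¬Du ∘ dominated u∈ , ¬Dv ∘ dominated v∈ ]′ (C₆-opposite i _ _
        (Equivalence.from (~⇔~ (from (_ , u∈)) (from (_ , v∈)))
          (subst₂ (InducedEdge G L) (sym (to∘from u∈)) (sym (to∘from v∈))
            (f~ (Equivalence.to (P.~⇔~ (0F , ∈⊤) (1F , ∈⊤)) refl) , u∈ , v∈)))
        (u≢y ∘ from-inj u∈) (v≢y ∘ from-inj v∈))
      where
      open Copy cp
      module P = _≅_ P₃≅F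
      to∘from : ∀ {u} (u∈ : u ∈ L) → proj₁ (to (from (u , u∈))) ≡ u
      to∘from u∈ = cong proj₁ (Inverse.strictlyInverseˡ bijection (_ , u∈))
      to-cong : ∀ {p q} → proj₁ p ≡ proj₁ q → proj₁ (to p) ≡ proj₁ (to q)
      to-cong {p} {q} eq = cong (proj₁ ∘ to) {p} {q} (vertex-≡ {G = C₆} eq)
      from-inj : ∀ {u} (u∈ : u ∈ L) → proj₁ (from (u , u∈)) ≡ i → u ≡ y
      from-inj u∈ eq = trans (sym (to∘from u∈)) (trans (to-cong eq) (to∘from y∈L))
      dominated : ∀ {u} (u∈ : u ∈ L) → Near C₆ (opposite i) (proj₁ (from (u , u∈))) → Dominated G ⁅ z ⁆ u
      dominated u∈ near = z , x∈⁅x⁆ z , Sum.map (λ eq → trans (sym (to∘from u∈)) (to-cong eq))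
        (λ adj → subst (z ~_) (to∘from u∈)
          (proj₁ (Equivalence.to (~⇔~ (opposite i , ∈⊤) (from (_ , u∈))) adj))) near

  -- Choose any `y` in `L` and treat it as deleted: the total `s + b` is at most e(L) + 2, one above
  -- the bound of `Good`.
  bad-sol : ∀ {X : Fin n → Set} {L} → Conn G L → Bad L → Sol X L (e G L + 2)
  bad-sol {L = L} L-conn bad with y , y∈L ← nonempty L-conn with b , b+s≤ , sol ← bad-hit L-conn bad y∈L =
    sol-mono (λ ()) (≤-trans (≤-reflexive (+-comm s b)) b+s≤)
      (hubSol⇒sol (add-hub y∈L id inj₂ (sol-mono inj₁ ≤-refl sol)))

  -- Components are treated one at a time, each paid for by its own share of the cost. `A` is an
  -- early exit, taken when a component settles the whole question in another way.
  peel : ∀ {A : Set} {X : Fin n → Set} {Y R} → Disjoint G Y R →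
    (∀ {L} → Component G R L → A ⊎ Sol X L (cost G Y L)) → A ⊎ Sol X R (cost G Y R)
  peel {A} {X} {Y} disj solve = go disj solve (<-wellFounded _)
    where
    go : ∀ {R} → Disjoint G Y R → (∀ {L} → Component G R L → A ⊎ Sol X L (cost G Y L)) →
         Acc ℕ._<_ ∣ R ∣ → A ⊎ Sol X R (cost G Y R)
    go {R} disj solve (acc rec) with nonempty? R
    ... | no R≡∅ = inj₂ (sol-mono id z≤n (sol-∅ λ cp → R≡∅ (_ , proj₁ (Copy.f∈ cp c₀∈F))))
    ... | yes (z , z∈R) with L , z∈L , comp ← component G z∈R with solve comp
    ...   | inj₁ done = inj₁ done
    ...   | inj₂ solL with go {R ─ L} (λ u∈Y → disj u∈Y ∘ p─q⊆p R L) (solve ∘ component-─ G comp)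
                              (rec (p∩q≢∅⇒∣p─q∣<∣p∣ R L (z , x∈p∩q⁺ (z∈R , z∈L))))
    ...     | inj₁ done = inj₁ done
    ...     | inj₂ sol  = inj₂ (sol-mono id (cost-split G disj L⊆R) (sol-∪ L⊆R (p─q⊆p R L) (∈∪─ R)
                (λ u∈L v∈ u~v → contradiction (closed u∈L (p─q⊆p R L v∈) u~v) (∈─⇒∉ R L v∈)) solL sol))
      where open Component comp

  -- Two copies of `F` joined by two disjoint edges

  -- Symmetric in the two edges and in the two sides, so that one argument at `x₁` covers all four
  -- ends.
  record TwoJoined (S M L : Subset n) (x₁ y₁ x₂ y₂ : Fin n) : Set where
    field
      M⊆S   : M ⊆ S
      L⊆S   : L ⊆ S
      cover : ∀ {u} → u ∈ S → u ∈ M ⊎ u ∈ L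
      disj  : Disjoint G M L
      M-conn : Conn G M
      L-conn : Conn G L
      eM≤k  : e G M ≤ k
      eL≤k  : e G L ≤ k
      x₁∈M  : x₁ ∈ M
      x₂∈M  : x₂ ∈ M
      y₁∈L  : y₁ ∈ L
      y₂∈L  : y₂ ∈ L
      x₁~y₁ : x₁ ~ y₁
      x₂~y₂ : x₂ ~ y₂
      x₁≢x₂ : x₁ ≢ x₂
      y₁≢y₂ : y₁ ≢ y₂
      cross : ∀ {x y} → x ∈ M → y ∈ L → x ~ y → (x ≡ x₁ × y ≡ y₁) ⊎ (x ≡ x₂ × y ≡ y₂)

  swap-edges : ∀ {S M L x₁ y₁ x₂ y₂} → TwoJoined S M L x₁ y₁ x₂ y₂ → TwoJoined S M L x₂ y₂ x₁ y₁
  swap-edges t = record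
    { M⊆S = M⊆S ; L⊆S = L⊆S ; cover = cover ; disj = disj ; M-conn = M-conn ; L-conn = L-conn
    ; eM≤k = eM≤k ; eL≤k = eL≤k ; x₁∈M = x₂∈M ; x₂∈M = x₁∈M ; y₁∈L = y₂∈L ; y₂∈L = y₁∈L
    ; x₁~y₁ = x₂~y₂ ; x₂~y₂ = x₁~y₁ ; x₁≢x₂ = x₁≢x₂ ∘ sym ; y₁≢y₂ = y₁≢y₂ ∘ sym
    ; cross = λ x∈ y∈ x~y → Sum.swap (cross x∈ y∈ x~y) }
    where open TwoJoined t

  swap-sides : ∀ {S M L x₁ y₁ x₂ y₂} → TwoJoined S M L x₁ y₁ x₂ y₂ → TwoJoined S L M y₁ x₁ y₂ x₂
  swap-sides t = record
    { M⊆S = L⊆S ; L⊆S = M⊆S ; cover = Sum.swap ∘ cover ; disj = λ u∈L u∈M → disj u∈M u∈L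
    ; M-conn = L-conn ; L-conn = M-conn
    ; eM≤k = eL≤k ; eL≤k = eM≤k ; x₁∈M = y₁∈L ; x₂∈M = y₂∈L ; y₁∈L = x₁∈M ; y₂∈L = x₂∈M
    ; x₁~y₁ = ~-sym x₁~y₁ ; x₂~y₂ = ~-sym x₂~y₂ ; x₁≢x₂ = y₁≢y₂ ; y₁≢y₂ = x₁≢x₂
    ; cross = λ y∈ x∈ y~x → Sum.map Product.swap Product.swap (cross x∈ y∈ (~-sym y~x)) }
    where open TwoJoined t

  -- The shape forced on one side by a copy that survives `x₁`. Having it in both orders, with
  -- nonadjacent ends, leaves only the path on three vertices.
  record Pendant (L : Subset n) (y₁ y₂ : Fin n) : Set where
    field
      y₂-adj  : ∀ {z} → z ∈ L → z ≢ y₁ → z ≢ y₂ → y₂ ~ z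
      y₁-leaf : ∀ {z z′} → z ∈ L → z′ ∈ L → y₁ ~ z → y₁ ~ z′ → z ≡ z′

  module _ {S M L : Subset n} {x₁ y₁ x₂ y₂ : Fin n} (t : TwoJoined S M L x₁ y₁ x₂ y₂) where
    open TwoJoined t

    Remaining : Fin n → Set
    Remaining u = u ∈ S × ¬ Near G x₁ u

    -- Neither side contains a copy avoiding x₁ or y₁, so a remaining copy uses the edge x₂y₂
    -- and its centre is one end of it. Counting edges rules out x₂, and forces the copy to be
    -- L - y₁ together with x₂ if its centre is y₂.
    surviving-copy : FCopy Remaining → ¬ x₁ ~ x₂ × Pendant L y₁ y₂
    surviving-copy cp with centre cp
    ... | c , (c∈S , ¬x₁c) , cp′ = conclude (meets M-conn eM≤k inM x₁∈M (λ near → near (inj₁ refl)))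
                                            (meets L-conn eL≤k inL y₁∈L (λ near → near (inj₂ x₁~y₁)))
      where
      Q : Fin n → Set
      Q u = Remaining u × Near G c u
      Q? : U.Decidable Q
      Q? u = ((u ∈? S) ×-dec ¬? (near? G x₁ u)) ×-dec near? G c u
      T : Subset n
      T = subsetOf Q?
      k≤eT : k ≤ e G T
      k≤eT = k≤e (copy-mono (∈subsetOf⁺ Q?) cp′)
      inM : ∀ {u} → u ∈ S → u ∉ L → u ∈ M
      inM u∈S u∉L = [ id , (λ u∈L → contradiction u∈L u∉L) ]′ (cover u∈S)
      inL : ∀ {u} → u ∈ S → u ∉ M → u ∈ L
      inL u∈S u∉M = [ (λ u∈M → contradiction u∈M u∉M) , id ]′ (cover u∈S)

      meets : ∀ {A B z} → Conn G A → e G A ≤ k → (∀ {u} → u ∈ S → u ∉ B → u ∈ A) → z ∈ A →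
              ¬ ¬ Near G x₁ z → ∃ λ u → Q u × u ∈ B
      meets {A} {B} A-conn eA≤k inA z∈A near with any? (λ u → Q? u ×-dec (u ∈? B))
      ... | yes meet = meet
      ... | no ¬meet = contradiction (proj₂ (proj₁ (copy-spans A-conn eA≤k cp′
                         (λ Qu → inA (proj₁ (proj₁ Qu)) (λ u∈B → ¬meet (_ , Qu , u∈B))) z∈A))) near

      cross-T : ∀ {u v} → Q u → u ∈ M → v ∈ L → u ~ v → u ≡ x₂ × v ≡ y₂
      cross-T Qu u∈M v∈L u~v with cross u∈M v∈L u~v
      ... | inj₁ (refl , _) = contradiction (inj₁ refl) (proj₂ (proj₁ Qu))
      ... | inj₂ eqs        = eqs

      eT≤ : ∀ {A} → (∀ {u v} → Q u → Q v → u ~ v → (u ∈ A × v ∈ A) ⊎ Joins x₂ y₂ u v) → e G T ≤ e G (T ∩ A) + 1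
      eT≤ {A} edges = subst (λ j → e G T ≤ e G (T ∩ A) + j) (count-joins (~⇒≢ G x₂~y₂))
        (count-cover (inducedEdge? G (T ∩ A)) (joins? x₂ y₂) (inducedEdge? G T) λ (u~v , u∈T , v∈T) →
          Sum.map₁ (λ (u∈A , v∈A) → u~v , x∈p∩q⁺ (u∈T , u∈A) , x∈p∩q⁺ (v∈T , v∈A))
            (edges (∈subsetOf⁻ Q? u∈T) (∈subsetOf⁻ Q? v∈T) u~v))

      -- Otherwise e(T ∩ A) + 2 ≤ e(A) ≤ k ≤ e(T) ≤ e(T ∩ A) + 1.
      no-two-extra : ∀ {A x y x′ y′} → e G A ≤ k → e G T ≤ e G (T ∩ A) + 1 →
        InducedEdge G A x y → ¬ InducedEdge G (T ∩ A) x y →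
        InducedEdge G A x′ y′ → ¬ InducedEdge G (T ∩ A) x′ y′ → ¬ ¬ Joins x y x′ y′
      no-two-extra {A} eA≤k eT≤ xy ¬xy x′y′ ¬x′y′ ¬same = contradiction
        (+-cancelˡ-≤ (e G (T ∩ A)) 2 1
          (≤-trans (e+2≤e G (p∩q⊆q T A) xy ¬xy x′y′ ¬x′y′ ¬same) (≤-trans eA≤k (≤-trans k≤eT eT≤))))
        λ { (s≤s ()) }

      Conclusion : Set
      Conclusion = ¬ x₁ ~ x₂ × Pendant L y₁ y₂

      conclude : (∃ λ q → Q q × q ∈ L) → (∃ λ p → Q p × p ∈ M) → Conclusion
      conclude (q , Qq , q∈L) (p , Qp , p∈M) with cover c∈S
      ... | inj₁ c∈M = contradiction-at-x₂ (c~q (proj₂ Qq))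
        where
        Qc : Q c
        Qc = (c∈S , ¬x₁c) , inj₁ refl
        c~q : Near G c q → c ≡ x₂
        c~q (inj₁ refl) = contradiction q∈L (disj c∈M)
        c~q (inj₂ c~q)  = proj₁ (cross-T Qc c∈M q∈L c~q)
        toL : ∀ {u} → Q u → u ∈ L → u ≡ y₂
        toL (_ , inj₁ refl) u∈L = contradiction u∈L (disj c∈M)
        toL (_ , inj₂ c~u)  u∈L = proj₂ (cross-T Qc c∈M u∈L c~u)
        edges : ∀ {u v} → Q u → Q v → u ~ v → (u ∈ M × v ∈ M) ⊎ Joins x₂ y₂ u v
        edges Qu Qv u~v with cover (proj₁ (proj₁ Qu)) | cover (proj₁ (proj₁ Qv))
        ... | inj₁ u∈M | inj₁ v∈M = inj₁ (u∈M , v∈M)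
        ... | inj₁ u∈M | inj₂ v∈L = inj₂ (inj₁ (cross-T Qu u∈M v∈L u~v))
        ... | inj₂ u∈L | inj₁ v∈M = inj₂ (inj₂ (Product.swap (cross-T Qv v∈M u∈L (~-sym u~v))))
        ... | inj₂ u∈L | inj₂ v∈L = contradiction (trans (toL Qu u∈L) (sym (toL Qv v∈L))) (~⇒≢ G u~v)
        contradiction-at-x₂ : c ≡ x₂ → Conclusion
        contradiction-at-x₂ refl
          -- Two edges of G[M] are missed by `T`: one at `x₁`, and one that leaves the closed
          -- neighbourhood of `x₁`, which exists because `x₂` is outside it.
          with z′ , z′∈M , z~z′ ← conn-neighbour G M-conn x₁∈M x₂∈M x₁≢x₂
          with u , w , u∈ , w∈M , w∉ , u~w ← boundary M-conn (M ∩ closedNbhd G x₁) (p∩q⊆p M _)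
                 (x₁ , x∈p∩q⁺ (x₁∈M , ∈closedNbhd⁺ G (inj₁ refl))) x₂∈M
                 (λ x₂∈ → ¬x₁c (∈closedNbhd⁻ G (p∩q⊆q M _ x₂∈)))
          = contradiction same (no-two-extra eM≤k (eT≤ edges) (z~z′ , x₁∈M , z′∈M)
              (λ (_ , x₁∈ , _) → notT (inj₁ refl) x₁∈)
              (u~w , p∩q⊆p M _ u∈ , w∈M) (λ (_ , u∈T , _) → notT u-near u∈T))
          where
          notT : ∀ {u} → Near G x₁ u → u ∉ T ∩ M
          notT near u∈ = proj₂ (proj₁ (∈subsetOf⁻ Q? (p∩q⊆p T M u∈))) near
          u-near : Near G x₁ u
          u-near = ∈closedNbhd⁻ G (p∩q⊆q M _ u∈)
          w-far : ¬ Near G x₁ w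
          w-far near = w∉ (x∈p∩q⁺ (w∈M , ∈closedNbhd⁺ G near))
          same : ¬ Joins x₁ z′ u w
          same (inj₁ (_ , refl)) = w-far (inj₂ z~z′)
          same (inj₂ (_ , refl)) = w-far (inj₁ refl)
      ... | inj₂ c∈L = pendant-at-y₂ (c~p (proj₂ Qp))
        where
        Qc : Q c
        Qc = (c∈S , ¬x₁c) , inj₁ refl
        c~p : Near G c p → p ≡ x₂ × c ≡ y₂
        c~p (inj₁ refl) = contradiction c∈L (disj p∈M)
        c~p (inj₂ c~p)  = cross-T Qp p∈M c∈L (~-sym c~p)
        toM : ∀ {u} → Q u → u ∈ M → u ≡ x₂
        toM (_ , inj₁ refl) u∈M = contradiction c∈L (disj u∈M)
        toM Qu@(_ , inj₂ c~u) u∈M = proj₁ (cross-T Qu u∈M c∈L (~-sym c~u))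
        edges : ∀ {u v} → Q u → Q v → u ~ v → (u ∈ L × v ∈ L) ⊎ Joins x₂ y₂ u v
        edges Qu Qv u~v with cover (proj₁ (proj₁ Qu)) | cover (proj₁ (proj₁ Qv))
        ... | inj₂ u∈L | inj₂ v∈L = inj₁ (u∈L , v∈L)
        ... | inj₁ u∈M | inj₂ v∈L = inj₂ (inj₁ (cross-T Qu u∈M v∈L u~v))
        ... | inj₂ u∈L | inj₁ v∈M = inj₂ (inj₂ (Product.swap (cross-T Qv v∈M u∈L (~-sym u~v))))
        ... | inj₁ u∈M | inj₁ v∈M = contradiction (trans (toM Qu u∈M) (sym (toM Qv v∈M))) (~⇒≢ G u~v)
        T′ : Subset n
        T′ = T ∩ L
        y₁∉T′ : y₁ ∉ T′
        y₁∉T′ y₁∈ = proj₂ (proj₁ (∈subsetOf⁻ Q? (p∩q⊆p T L y₁∈))) (inj₂ x₁~y₁)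
        -- At most one edge of G[L] lies outside `T′`. As `y₁` is not in `T′`, it is the edge at
        -- `y₁`, and connectivity makes `T′` all of `L` but `y₁`.
        same-edge : ∀ {x y x′ y′} → InducedEdge G L x y → ¬ InducedEdge G T′ x y →
                    InducedEdge G L x′ y′ → ¬ InducedEdge G T′ x′ y′ → Joins x y x′ y′
        same-edge xy ¬xy x′y′ ¬x′y′ =
          decidable-stable (joins? _ _ _ _) (no-two-extra eL≤k (eT≤ edges) xy ¬xy x′y′ ¬x′y′)
        pendant-at-y₂ : p ≡ x₂ × c ≡ y₂ → Conclusion
        pendant-at-y₂ (refl , refl)
          with z₀ , z₀∈L , y₁~z₀ ← conn-neighbour G L-conn y₁∈L y₂∈L y₁≢y₂
          = (λ x₁~x₂ → proj₂ (proj₁ Qp) (inj₂ x₁~x₂)) , record { y₂-adj = y₂-adj ; y₁-leaf = y₁-leaf }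
          where
          from-y₁ : ∀ {z} → y₁ ~ z → ¬ InducedEdge G T′ y₁ z
          from-y₁ _ (_ , y₁∈ , _) = y₁∉T′ y₁∈
          y₂∈T′ : y₂ ∈ T′
          y₂∈T′ = x∈p∩q⁺ (∈subsetOf⁺ Q? Qc , c∈L)
          z₀∈T′ : z₀ ∈ T′
          z₀∈T′
            with u , w , u∈ , w∈L , w∉ , u~w ← boundary L-conn T′ (p∩q⊆q T L) (_ , y₂∈T′) y₁∈L y₁∉T′
            with same-edge (y₁~z₀ , y₁∈L , z₀∈L) (from-y₁ y₁~z₀)
                   (u~w , p∩q⊆q T L u∈ , w∈L) (λ (_ , _ , w∈) → w∉ w∈)
          ... | inj₁ (refl , _) = contradiction u∈ y₁∉T′
          ... | inj₂ (refl , _) = u∈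
          spans : ∀ {z} → z ∈ L → z ≢ y₁ → z ∈ T′
          spans {z} z∈L z≢y₁ = decidable-stable (z ∈? T′) absurd
            where
            absurd : ¬ z ∉ T′
            absurd z∉T′
              with u , w , u∈ , w∈L , w∉ , u~w ← boundary L-conn (T′ ∪ ⁅ y₁ ⁆)
                     (λ u∈ → [ p∩q⊆q T L , (⁅x⁆⊆ y₁∈L) ]′ (x∈p∪q⁻ T′ _ u∈))
                     (_ , p⊆p∪q ⁅ y₁ ⁆ y₂∈T′) z∈L
                     (λ z∈ → [ z∉T′ , z≢y₁ ∘ x∈⁅y⁆⇒x≡y y₁ ]′ (x∈p∪q⁻ T′ _ z∈))
              with same-edge (y₁~z₀ , y₁∈L , z₀∈L) (from-y₁ y₁~z₀)
                     (u~w , [ p∩q⊆q T L , (⁅x⁆⊆ y₁∈L) ]′ (x∈p∪q⁻ T′ _ u∈) , w∈L)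
                     (λ (_ , _ , w∈) → w∉ (p⊆p∪q ⁅ y₁ ⁆ w∈))
            ... | inj₁ (_ , refl) = w∉ (p⊆p∪q ⁅ y₁ ⁆ z₀∈T′)
            ... | inj₂ (_ , refl) = w∉ (q⊆p∪q T′ ⁅ y₁ ⁆ (x∈⁅x⁆ y₁))
          y₂-adj : ∀ {z} → z ∈ L → z ≢ y₁ → z ≢ y₂ → y₂ ~ z
          y₂-adj z∈L z≢y₁ z≢y₂ with ∈subsetOf⁻ Q? (p∩q⊆p T L (spans z∈L z≢y₁))
          ... | _ , inj₁ z≡y₂ = contradiction z≡y₂ z≢y₂
          ... | _ , inj₂ y₂~z = y₂~z
          y₁-leaf : ∀ {z z′} → z ∈ L → z′ ∈ L → y₁ ~ z → y₁ ~ z′ → z ≡ z′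
          y₁-leaf z∈L z′∈L y₁~z y₁~z′
            with same-edge (y₁~z , y₁∈L , z∈L) (from-y₁ y₁~z) (y₁~z′ , y₁∈L , z′∈L) (from-y₁ y₁~z′)
          ... | inj₁ (_ , eq)   = sym eq
          ... | inj₂ (eq , _)   = contradiction eq (~⇒≢ G y₁~z)

  record Path (L : Subset n) (p q : Fin n) : Set where
    field
      u     : Fin n
      u∈L   : u ∈ L
      p~u   : p ~ u
      u~q   : u ~ q
      p≁q   : ¬ p ~ q
      only  : ∀ {z} → z ∈ L → z ≡ p ⊎ z ≡ u ⊎ z ≡ q

  -- By the second shape every further vertex is a neighbour of `p`, and by the first `p` has only
  -- one.
  pendants⇒path : ∀ {L p q} → Conn G L → p ∈ L → q ∈ L → p ≢ q → ¬ p ~ q →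
                  Pendant L p q → Pendant L q p → Path L p q
  pendants⇒path {L} {p} {q} L-conn p∈L q∈L p≢q p≁q pq qp
    with u , u∈L , p~u ← conn-neighbour G L-conn p∈L q∈L p≢q = record
    { u = u ; u∈L = u∈L ; p~u = p~u ; u~q = ~-sym (Pendant.y₂-adj pq u∈L (~⇒≢ G p~u ∘ sym) λ { refl → p≁q p~u })
    ; p≁q = p≁q ; only = only }
    where
    only : ∀ {z} → z ∈ L → z ≡ p ⊎ z ≡ u ⊎ z ≡ q
    only {z} z∈L with z ≟ p | z ≟ q
    ... | yes z≡p | _       = inj₁ z≡p
    ... | no _    | yes z≡q = inj₂ (inj₂ z≡q)
    ... | no z≢p  | no z≢q  = inj₂ (inj₁ (Pendant.y₁-leaf pq z∈L u∈L (Pendant.y₂-adj qp z∈L z≢q z≢p) p~u))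

  path⇒P₃≅ : ∀ {L p q} → p ∈ L → q ∈ L → p ≢ q → Path L p q → P₃ ≅ induced G L
  path⇒P₃≅ {L} {p} {q} p∈L q∈L p≢q path = table⇒≅ P₃ G f (λ _ → ∈⊤) f∈ surj table
    where
    open Path path
    f : Fin 3 → Fin n
    f 0F = p
    f 1F = u
    f 2F = q
    f∈ : ∀ i → f i ∈ L
    f∈ 0F = p∈L
    f∈ 1F = u∈L
    f∈ 2F = q∈L
    surj : ∀ {z} → z ∈ L → ∃ λ i → f i ≡ z
    surj z∈L with only z∈L
    ... | inj₁ refl        = 0F , refl
    ... | inj₂ (inj₁ refl) = 1F , refl
    ... | inj₂ (inj₂ refl) = 2F , refl
    pq : Entry P₃ G f 0F 2F
    pq = apart (λ ()) p≁q p≢q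
    table : ∀ i j → Entry P₃ G f i j
    table 0F 0F = equal refl
    table 0F 1F = adjacent refl p~u
    table 0F 2F = pq
    table 1F 0F = adjacent refl (~-sym p~u)
    table 1F 1F = equal refl
    table 1F 2F = adjacent refl u~q
    table 2F 0F = entry-sym P₃ G f pq
    table 2F 1F = adjacent refl (~-sym u~q)
    table 2F 2F = equal refl

  -- The cycle goes from `x₁` to `x₂` through `M` and back from `y₂` to `y₁` through `L`; `cross`
  -- rules out chords between the sides.
  paths⇒C₆≅ : ∀ {S M L x₁ y₁ x₂ y₂} → TwoJoined S M L x₁ y₁ x₂ y₂ →
              Path M x₁ x₂ → Path L y₁ y₂ → C₆ ≅ induced G S
  paths⇒C₆≅ {S} {M} {L} {x₁} {y₁} {x₂} {y₂} t pathM pathL = table⇒≅ C₆ G f (λ _ → ∈⊤) f∈ surj table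
    where
    open TwoJoined t
    module M = Path pathM
    module L = Path pathL
    f : Fin 6 → Fin n
    f 0F = x₁
    f 1F = M.u
    f 2F = x₂
    f 3F = y₂
    f 4F = L.u
    f 5F = y₁
    f∈ : ∀ i → f i ∈ S
    f∈ 0F = M⊆S x₁∈M
    f∈ 1F = M⊆S M.u∈L
    f∈ 2F = M⊆S x₂∈M
    f∈ 3F = L⊆S y₂∈L
    f∈ 4F = L⊆S L.u∈L
    f∈ 5F = L⊆S y₁∈L
    surj : ∀ {z} → z ∈ S → ∃ λ i → f i ≡ z
    surj z∈S with cover z∈S
    ... | inj₁ z∈M with M.only z∈M
    ...   | inj₁ refl        = 0F , refl
    ...   | inj₂ (inj₁ refl) = 1F , refl
    ...   | inj₂ (inj₂ refl) = 2F , refl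
    surj z∈S | inj₂ z∈L with L.only z∈L
    ...   | inj₁ refl        = 5F , refl
    ...   | inj₂ (inj₁ refl) = 4F , refl
    ...   | inj₂ (inj₂ refl) = 3F , refl
    far : ∀ i j → {Dec.False (Graph._~?_ C₆ i j)} → f i ∈ M → f j ∈ L →
          ¬ (f i ≡ x₁ × f j ≡ y₁) → ¬ (f i ≡ x₂ × f j ≡ y₂) → Entry C₆ G f i j
    far i j {w} i∈M j∈L ≢₁ ≢₂ = apart (Dec.toWitnessFalse w) (λ i~j → [ ≢₁ , ≢₂ ]′ (cross i∈M j∈L i~j))
                                      (λ eq → disj i∈M (subst (_∈ L) (sym eq) j∈L))
    e01 : Entry C₆ G f 0F 1F
    e01 = adjacent (inj₁ refl) M.p~u
    e02 : Entry C₆ G f 0F 2F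
    e02 = apart (λ { (inj₁ ()) ; (inj₂ ()) }) M.p≁q x₁≢x₂
    e03 : Entry C₆ G f 0F 3F
    e03 = far 0F 3F x₁∈M y₂∈L (y₁≢y₂ ∘ sym ∘ proj₂) (x₁≢x₂ ∘ proj₁)
    e04 : Entry C₆ G f 0F 4F
    e04 = far 0F 4F x₁∈M L.u∈L (~⇒≢ G L.p~u ∘ sym ∘ proj₂) (~⇒≢ G L.u~q ∘ proj₂)
    e05 : Entry C₆ G f 0F 5F
    e05 = adjacent (inj₂ refl) x₁~y₁
    e12 : Entry C₆ G f 1F 2F
    e12 = adjacent (inj₁ refl) M.u~q
    e13 : Entry C₆ G f 1F 3F
    e13 = far 1F 3F M.u∈L y₂∈L (~⇒≢ G M.p~u ∘ sym ∘ proj₁) (~⇒≢ G M.u~q ∘ proj₁)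
    e14 : Entry C₆ G f 1F 4F
    e14 = far 1F 4F M.u∈L L.u∈L (~⇒≢ G M.p~u ∘ sym ∘ proj₁) (~⇒≢ G M.u~q ∘ proj₁)
    e15 : Entry C₆ G f 1F 5F
    e15 = far 1F 5F M.u∈L y₁∈L (~⇒≢ G M.p~u ∘ sym ∘ proj₁) (~⇒≢ G M.u~q ∘ proj₁)
    e23 : Entry C₆ G f 2F 3F
    e23 = adjacent (inj₁ refl) x₂~y₂
    e24 : Entry C₆ G f 2F 4F
    e24 = far 2F 4F x₂∈M L.u∈L (x₁≢x₂ ∘ sym ∘ proj₁) (~⇒≢ G L.u~q ∘ proj₂)
    e25 : Entry C₆ G f 2F 5F
    e25 = far 2F 5F x₂∈M y₁∈L (x₁≢x₂ ∘ sym ∘ proj₁) (y₁≢y₂ ∘ proj₂)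
    e34 : Entry C₆ G f 3F 4F
    e34 = adjacent (inj₁ refl) (~-sym L.u~q)
    e35 : Entry C₆ G f 3F 5F
    e35 = apart (λ { (inj₁ ()) ; (inj₂ ()) }) (L.p≁q ∘ ~-sym) (y₁≢y₂ ∘ sym)
    e45 : Entry C₆ G f 4F 5F
    e45 = adjacent (inj₁ refl) (~-sym L.p~u)
    mirror : ∀ {i j} → Entry C₆ G f i j → Entry C₆ G f j i
    mirror = entry-sym C₆ G f
    table : ∀ i j → Entry C₆ G f i j
    table 0F 0F = equal refl
    table 0F 1F = e01
    table 0F 2F = e02
    table 0F 3F = e03
    table 0F 4F = e04
    table 0F 5F = e05
    table 1F 0F = mirror e01
    table 1F 1F = equal refl
    table 1F 2F = e12
    table 1F 3F = e13
    table 1F 4F = e14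
    table 1F 5F = e15
    table 2F 0F = mirror e02
    table 2F 1F = mirror e12
    table 2F 2F = equal refl
    table 2F 3F = e23
    table 2F 4F = e24
    table 2F 5F = e25
    table 3F 0F = mirror e03
    table 3F 1F = mirror e13
    table 3F 2F = mirror e23
    table 3F 3F = equal refl
    table 3F 4F = e34
    table 3F 5F = e35
    table 4F 0F = mirror e04
    table 4F 1F = mirror e14
    table 4F 2F = mirror e24
    table 4F 3F = mirror e34
    table 4F 4F = equal refl
    table 4F 5F = e45
    table 5F 0F = mirror e05
    table 5F 1F = mirror e15
    table 5F 2F = mirror e25
    table 5F 3F = mirror e35
    table 5F 4F = mirror e45
    table 5F 5F = equal refl

  single⇒good : ∀ {S x} → x ∈ S → s ≤ e G S + 1 → ¬ FCopy (λ u → u ∈ S × ¬ Near G x u) → Good S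
  single⇒good x∈S s≤ ¬cp = sol-mono id (≤-trans (≤-reflexive (+-identityʳ s)) s≤)
    (hubSol⇒sol (add-hub x∈S id inj₂ (sol-∅ ¬cp)))

  -- One vertex is affordable since `s ≤ e G S + 1`, so otherwise a copy survives each of the four
  -- ends. The shapes this forces make both sides paths on three vertices and G[S] a 6-cycle.
  twoJoined⇒good⊎bad : ∀ {S M L x₁ y₁ x₂ y₂} → TwoJoined S M L x₁ y₁ x₂ y₂ → F ≅ induced G L → s ≤ e G S + 1 →
                       Good S ⊎ Bad S
  twoJoined⇒good⊎bad {S} {M} {L} {x₁} {y₁} {x₂} {y₂} t F≅L s≤
    with copy? (λ u → (u ∈? S) ×-dec ¬? (near? G x₁ u)) | copy? (λ u → (u ∈? S) ×-dec ¬? (near? G x₂ u))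
       | copy? (λ u → (u ∈? S) ×-dec ¬? (near? G y₁ u)) | copy? (λ u → (u ∈? S) ×-dec ¬? (near? G y₂ u))
  ... | no ¬cp | _ | _ | _ = inj₁ (single⇒good (TwoJoined.M⊆S t (TwoJoined.x₁∈M t)) s≤ ¬cp)
  ... | _ | no ¬cp | _ | _ = inj₁ (single⇒good (TwoJoined.M⊆S t (TwoJoined.x₂∈M t)) s≤ ¬cp)
  ... | _ | _ | no ¬cp | _ = inj₁ (single⇒good (TwoJoined.L⊆S t (TwoJoined.y₁∈L t)) s≤ ¬cp)
  ... | _ | _ | _ | no ¬cp = inj₁ (single⇒good (TwoJoined.L⊆S t (TwoJoined.y₂∈L t)) s≤ ¬cp)
  ... | yes cx₁ | yes cx₂ | yes cy₁ | yes cy₂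
    with x₁≁x₂ , y₁-pendant ← surviving-copy t cx₁
       | _     , y₂-pendant ← surviving-copy (swap-edges t) cx₂
       | y₁≁y₂ , x₁-pendant ← surviving-copy (swap-sides t) cy₁
       | _     , x₂-pendant ← surviving-copy (swap-sides (swap-edges t)) cy₂
    = inj₂ (inj₂ (≅-trans (path⇒P₃≅ y₁∈L y₂∈L y₁≢y₂ pathL) (≅-sym F≅L) , paths⇒C₆≅ t pathM pathL))
    where
    open TwoJoined t
    pathL : Path L y₁ y₂
    pathL = pendants⇒path L-conn y₁∈L y₂∈L y₁≢y₂ y₁≁y₂ y₁-pendant y₂-pendant
    pathM : Path M x₁ x₂
    pathM = pendants⇒path M-conn x₁∈M x₂∈M x₁≢x₂ x₁≁x₂ x₁-pendant x₂-pendant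

  -- Deleting a vertex or a closed neighbourhood

  attached : ∀ {S Y L} → Conn G S → Y ⊆ S → Nonempty Y → Component G (S ─ Y) L → ∃₂ (Link G Y L)
  attached {S} {Y} {L} S-conn Y⊆S (z , z∈Y) comp
    with u , w , u∈L , w∈S , w∉L , u~w ← boundary S-conn L (p─q⊆p S Y ∘ Component.L⊆R comp)
           (nonempty (Component.conn comp)) (Y⊆S z∈Y) (λ z∈L → ∈─⇒∉ S Y (Component.L⊆R comp z∈L) z∈Y)
    with w ∈? Y
  ... | yes w∈Y = w , u , w∈Y , u∈L , ~-sym u~w
  ... | no w∉Y  = contradiction (Component.closed comp u∈L (x∈p∧x∉q⇒x∈p─q w∈S w∉Y) u~w) w∉L

  SolvedBelow : Subset n → Set
  SolvedBelow S = ∀ {T} → T ⊂ S → Conn G T → Good T ⊎ Bad T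

  module Step {S : Subset n} (ih : SolvedBelow S) (S-conn : Conn G S) where

    module Hub {Y x} (Y⊆S : Y ⊆ S) (x∈Y : x ∈ Y) where

      hub-disjoint : Disjoint G Y (S ─ Y)
      hub-disjoint u∈Y u∈R = ∈─⇒∉ S Y u∈R u∈Y

      comp-disjoint : ∀ {L} → Component G (S ─ Y) L → Disjoint G Y L
      comp-disjoint comp u∈Y u∈L = hub-disjoint u∈Y (Component.L⊆R comp u∈L)

      comp⊂ : ∀ {L} → Component G (S ─ Y) L → L ⊂ S
      comp⊂ comp = p─q⊆p S Y ∘ Component.L⊆R comp , x , Y⊆S x∈Y , comp-disjoint comp x∈Y

      link : ∀ {L} → Component G (S ─ Y) L → ∃₂ (Link G Y L)
      link = attached S-conn Y⊆S (x , x∈Y)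

    module Vertex {x} (x∈S : x ∈ S) where
      open Hub {⁅ x ⁆} {x} (⁅x⁆⊆ x∈S) (x∈⁅x⁆ x)

      link-x : ∀ {L} → Component G (S ─ ⁅ x ⁆) L → ∃ λ y → y ∈ L × x ~ y
      link-x comp with x′ , y , x′∈ , y∈L , x′~y ← link comp =
        y , y∈L , subst (_~ y) (x∈⁅y⁆⇒x≡y x x′∈) x′~y

      -- `x` has a neighbour in `L` and dominates it, so the deletion that `bad-hit` asks for is
      -- free.
      hit : ∀ {L} → Component G (S ─ ⁅ x ⁆) L → Bad L → ∃ λ b → b + s ≤ e G L + 2 × Sol (Near G x) L b
      hit comp bad
        with y , y∈L , x~y ← link-x comp
        with b , b+s≤ , sol ← bad-hit (Component.conn comp) bad y∈L =
        b , b+s≤ , sol-mono (λ { refl → inj₂ x~y }) ≤-refl sol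

      e+1≤cost-x : ∀ {L} → Component G (S ─ ⁅ x ⁆) L → e G L + 1 ≤ cost G ⁅ x ⁆ L
      e+1≤cost-x comp with y , y∈L , x~y ← link-x comp = e+1≤cost G (comp-disjoint comp) (x∈⁅x⁆ x , y∈L , x~y)

      comp-sol : ∀ {L} → Component G (S ─ ⁅ x ⁆) L → Sol (Near G x) L (cost G ⁅ x ⁆ L)
      comp-sol comp with ih (comp⊂ comp) (Component.conn comp)
      ... | inj₁ good = sol-mono (λ ()) (e+1≤cost-x comp) good
      ... | inj₂ bad with b , b+s≤ , sol ← hit comp bad =
        sol-mono id (≤-trans (slack b+s≤) (e+1≤cost-x comp)) sol

      cover : ∀ {u} → u ∈ S → Near G x u ⊎ u ∈ S ─ ⁅ x ⁆
      cover u∈S = Sum.map₁ (inj₁ ∘ x∈⁅y⁆⇒x≡y x) (∈∪─ S u∈S)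

      cost≤e : cost G ⁅ x ⁆ (S ─ ⁅ x ⁆) ≤ e G S
      cost≤e = m+n≤o⇒n≤o (e G ⁅ x ⁆) (e+cost≤e G hub-disjoint (⁅x⁆⊆ x∈S) (p─q⊆p S ⁅ x ⁆))

      -- Every component of S - x, special or not, is paid for by its own cost; only `x` itself
      -- comes on top.
      through-vertex : HubSol x S (s + e G S)
      through-vertex with peel {A = Empty} hub-disjoint (inj₂ ∘ comp-sol)
      ... | inj₂ sol = add-hub x∈S (p─q⊆p S ⁅ x ⁆) cover (sol-mono id cost≤e sol)

      -- By `b + s ≤ e G L + 2` the special component saves enough to pay for `x` as well.
      bad-component⇒good : ∀ {L} → Component G (S ─ ⁅ x ⁆) L → Bad L → Good S
      bad-component⇒good {L} comp bad
        with b , b+s≤ , sol ← hit comp bad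
        with peel {A = Empty} (λ u∈ → hub-disjoint u∈ ∘ p─q⊆p (S ─ ⁅ x ⁆) L)
                  (inj₂ ∘ comp-sol ∘ component-─ G comp)
      ... | inj₂ rest = sol-mono id
        (cut-bound {k} b+s≤ (e+1≤cost-x comp) (cost-split G hub-disjoint L⊆R) cost≤e)
        (hubSol⇒sol (add-hub x∈S (p─q⊆p S ⁅ x ⁆) cover
          (sol-∪ L⊆R (p─q⊆p (S ─ ⁅ x ⁆) L) (∈∪─ (S ─ ⁅ x ⁆))
            (λ u∈L v∈ u~v → contradiction (closed u∈L (p─q⊆p _ L v∈) u~v) (∈─⇒∉ _ L v∈)) sol rest)))
        where open Component comp

    open Vertex using (through-vertex; bad-component⇒good) public

    module Neighbourhood {v} (v∈S : v ∈ S) where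

      Y : Subset n
      Y = S ∩ closedNbhd G v

      Y⊆S : Y ⊆ S
      Y⊆S = p∩q⊆p S _

      ∈Y : ∀ {u} → u ∈ S → Near G v u → u ∈ Y
      ∈Y u∈S near = x∈p∩q⁺ (u∈S , ∈closedNbhd⁺ G near)

      ∈Y⁻ : ∀ {u} → u ∈ Y → Near G v u
      ∈Y⁻ = ∈closedNbhd⁻ G ∘ p∩q⊆q S _

      v∈Y : v ∈ Y
      v∈Y = ∈Y v∈S (inj₁ refl)

      open Hub Y⊆S v∈Y public

      Comp : Subset n → Set
      Comp = Component G (S ─ Y)

      leaves : ∀ {L} → Comp L → ∀ {y w} → y ∈ L → w ∈ S → w ∉ L → y ~ w → w ∈ Y
      leaves comp {y} {w} y∈L w∈S w∉L y~w with w ∈? Y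
      ... | yes w∈Y = w∈Y
      ... | no w∉Y  = contradiction (Component.closed comp y∈L (x∈p∧x∉q⇒x∈p─q w∈S w∉Y) y~w) w∉L

      -- If all links of `L` start at `x`, then `L` is even a component of S - x, and
      -- `bad-component⇒good` applies.
      second-link : ∀ {L x y} → Comp L → Bad L → Link G Y L x y →
                    Good S ⊎ ∃₂ λ x′ y′ → Link G Y L x′ y′ × x′ ≢ x
      second-link {L} {x} comp bad (x∈Y , _)
        with any? (λ x′ → any? (λ y′ → link? G Y L x′ y′ ×-dec ¬? (x′ ≟ x)))
      ... | yes other = inj₂ other
      ... | no ¬other = inj₁ (bad-component⇒good (Y⊆S x∈Y) comp-x bad)
        where
        open Component comp
        comp-x : Component G (S ─ ⁅ x ⁆) L
        comp-x = record
          { L⊆R = λ u∈L → x∈p∧x∉q⇒x∈p─q (p─q⊆p S Y (L⊆R u∈L))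
              (λ u∈x → comp-disjoint comp x∈Y (subst (_∈ L) (x∈⁅y⁆⇒x≡y x u∈x) u∈L))
          ; conn = conn
          ; closed = λ {u} {w} u∈L w∈ u~w → decidable-stable (w ∈? L) λ w∉L →
              ¬other (w , u , (leaves comp u∈L (p─q⊆p S ⁅ x ⁆ w∈) w∉L u~w , u∈L , ~-sym u~w)
                     , λ { refl → ∈─⇒∉ S ⁅ x ⁆ w∈ (x∈⁅x⁆ x) })
          }

      -- One link pays the `+ 1` of a good component. A special one needs e(L) + 2, which two links
      -- provide.
      comp-sol : ∀ {L} → Comp L → Good S ⊎ Sol (Near G v) L (cost G Y L)
      comp-sol comp with x , y , l ← link comp with ih (comp⊂ comp) (Component.conn comp)
      ... | inj₁ good = inj₂ (sol-mono (λ ()) (e+1≤cost G (comp-disjoint comp) l) good)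
      ... | inj₂ bad with second-link comp bad l
      ...   | inj₁ done = inj₁ done
      ...   | inj₂ (x′ , y′ , l′ , x′≢x) = inj₂ (sol-mono id
                (e+2≤cost G (comp-disjoint comp) l l′ (x′≢x ∘ sym ∘ proj₁)) (bad-sol (Component.conn comp) bad))

      cover : ∀ {u} → u ∈ S → Near G v u ⊎ u ∈ S ─ Y
      cover u∈S = Sum.map₁ ∈Y⁻ (∈∪─ S u∈S)

      e+rest≤e : e G Y + cost G Y (S ─ Y) ≤ e G S
      e+rest≤e = e+cost≤e G hub-disjoint Y⊆S (p─q⊆p S Y)

      -- The `k + 1` edges inside `Y` and the `+ 1` of the bound pay the full `s` for `v`.
      heavy⇒good : k + 1 ≤ e G Y → Good S
      heavy⇒good heavy with peel hub-disjoint comp-sol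
      ... | inj₁ done = done
      ... | inj₂ sol  = sol-mono id (heavy-bound heavy e+rest≤e)
                          (hubSol⇒sol (add-hub v∈S (p─q⊆p S Y) cover sol))

      spare⇒good : ∀ {L b} → k ≤ e G Y → Comp L → Sol (Near G v) L b → b + 1 ≤ cost G Y L → Good S
      spare⇒good {L} k≤ comp sol spare
        with peel (λ u∈ → hub-disjoint u∈ ∘ p─q⊆p (S ─ Y) L) (comp-sol ∘ component-─ G comp)
      ... | inj₁ done = done
      ... | inj₂ rest = sol-mono id (spare-bound k≤ spare (cost-split G hub-disjoint L⊆R) e+rest≤e)
        (hubSol⇒sol (add-hub v∈S (p─q⊆p S Y) cover
          (sol-∪ L⊆R (p─q⊆p (S ─ Y) L) (∈∪─ (S ─ Y))
            (λ u∈L v∈ u~v → contradiction (closed u∈L (p─q⊆p _ L v∈) u~v) (∈─⇒∉ _ L v∈)) sol rest)))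
        where open Component comp

    open Neighbourhood using (heavy⇒good)

    -- The three edges at `y` are at least `k + 1`, and `heavy⇒good` applies to any vertex, not just
    -- to the centre of a copy.
    degree3⇒good : ∀ {y p q r} → k ≤ 2 → y ∈ S → p ∈ S → q ∈ S → r ∈ S → y ~ p → y ~ q → y ~ r →
                   p ≢ q → p ≢ r → q ≢ r → Good S
    degree3⇒good {y} {p} {q} {r} k≤2 y∈S p∈S q∈S r∈S y~p y~q y~r p≢q p≢r q≢r =
      heavy⇒good y∈S (≤-trans (+-monoˡ-≤ 1 k≤2) (≤-trans (m≤n+m 3 (e G N)) (≤-trans
        (e+3≤cost G disj (link-y p∈S y~p) (link-y q∈S y~q) (link-y r∈S y~r)
          (p≢q ∘ proj₂) (p≢r ∘ proj₂) (q≢r ∘ proj₂))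
        (m+n≤o⇒n≤o (e G ⁅ y ⁆) (e+cost≤e G disj (⁅x⁆⊆ v∈Y) (p─q⊆p Y ⁅ y ⁆))))))
      where
      open Neighbourhood y∈S using (Y; ∈Y; v∈Y)
      N : Subset n
      N = Y ─ ⁅ y ⁆
      disj : Disjoint G ⁅ y ⁆ N
      disj u∈y u∈N = ∈─⇒∉ Y ⁅ y ⁆ u∈N u∈y
      link-y : ∀ {u} → u ∈ S → y ~ u → Link G ⁅ y ⁆ N y u
      link-y u∈S y~u = x∈⁅x⁆ y , x∈p∧x∉q⇒x∈p─q (∈Y u∈S (inj₂ y~u))
        (λ u∈y → ~⇒≢ G y~u (sym (x∈⁅y⁆⇒x≡y y u∈y))) , y~u

    -- `y` has two neighbours on the cycle and a third, `x`, off it.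
    C₆-attached⇒good : ∀ {L x y} → P₃ ≅ F → C₆ ≅ induced G L → L ⊆ S → x ∈ S → x ∉ L → y ∈ L → x ~ y → Good S
    C₆-attached⇒good {L} {x} {y} P₃≅F C₆≅L L⊆S x∈S x∉L y∈L x~y
      with C₆-two-neighbours (proj₁ (_≅_.from C₆≅L (y , y∈L)))
    ... | p , q , p≢q , i~p , i~q = degree3⇒good (P₃≅F⇒k≤2 P₃≅F) (L⊆S y∈L)
        (L⊆S (to∈ p)) (L⊆S (to∈ q)) x∈S (y~to i~p) (y~to i~q) (~-sym x~y)
        (λ eq → p≢q (cong proj₁ (≅-injective C₆≅L eq))) (λ { refl → x∉L (to∈ p) }) (λ { refl → x∉L (to∈ q) })
      where
      open _≅_ C₆≅L
      to∈ : ∀ p → proj₁ (to (p , ∈⊤)) ∈ L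
      to∈ p = proj₂ (to (p , ∈⊤))
      y~to : ∀ {p} → Graph._~_ C₆ (proj₁ (from (y , y∈L))) p → y ~ proj₁ (to (p , ∈⊤))
      y~to {p} adj = subst (_~ proj₁ (to (p , ∈⊤))) (cong proj₁ (Inverse.strictlyInverseˡ bijection (y , y∈L)))
        (proj₁ (Equivalence.to (~⇔~ (from (y , y∈L)) (p , ∈⊤)) adj))

  -- The tight case: splitting off one component

  module Remainder {S : Subset n} (ih : SolvedBelow S) (S-conn : Conn G S) {v} (v∈S : v ∈ S) where
    open Step ih S-conn
    open Neighbourhood v∈S

    module _ {L : Subset n} (k≤eY : k ≤ e G Y) (comp : Comp L) where
      open Component comp

      M : Subset n
      M = S ─ L

      L⊆S : L ⊆ S
      L⊆S = proj₁ (comp⊂ comp)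

      disj : Disjoint G M L
      disj = ∈─⇒∉ S L

      Y⇒M : ∀ {u} → u ∈ Y → u ∈ M
      Y⇒M u∈Y = x∈p∧x∉q⇒x∈p─q (Y⊆S u∈Y) (comp-disjoint comp u∈Y)

      M-conn : Conn G M
      -- Every outside neighbour of `L` in `S` is near `v`, and it is not `v` itself, whose
      -- neighbours in `S` all lie in `Y`.
      M-conn = conn-complement G S-conn L⊆S v∈S (comp-disjoint comp v∈Y) λ y∈L w∈S w∉L y~w →
        [ (λ { refl → contradiction y∈L (comp-disjoint comp (∈Y (L⊆S y∈L) (inj₂ (~-sym y~w)))) }) , id ]′
        (∈Y⁻ (leaves comp y∈L w∈S w∉L y~w))

      M⊂S : M ⊂ S
      M⊂S with z , z∈L ← nonempty conn = p─q⊆p S L , z , L⊆S z∈L , λ z∈M → disj z∈M z∈L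

      S-cover : ∀ {u} → u ∈ S → u ∈ L ⊎ u ∈ M
      S-cover = ∈∪─ S

      M-L-link : ∀ {u w} → u ∈ M → w ∈ L → u ~ w → Link G Y L u w
      M-L-link u∈M w∈L u~w = leaves comp w∈L (p─q⊆p S L u∈M) (∈─⇒∉ S L u∈M) (~-sym u~w) , w∈L , u~w

      link⇒M : ∀ {u w} → Link G Y L u w → Link G M L u w
      link⇒M (u∈Y , rest) = Y⇒M u∈Y , rest

      eM+cost≤ : e G M + cost G M L ≤ e G S
      eM+cost≤ = e+cost≤e G disj (p─q⊆p S L) L⊆S

      -- If `M` is special, the deletion of `x` brings it within the bound.
      M-sol : ∀ {x} → x ∈ M → Sol (_≡ x) M (e G M + 1)
      M-sol x∈M with ih M⊂S M-conn
      ... | inj₁ good = sol-mono (λ ()) ≤-refl good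
      ... | inj₂ bad with b , b+s≤ , sol ← bad-hit M-conn bad x∈M = sol-mono id (slack b+s≤) sol

      -- Since s divides e(L) + 1, the bound |D| s ≤ s + e(L) for a D through y improves to |D| s ≤ e(L) + 1.
      bridge⇒good : ∀ {x y} → Link G Y L x y → (∀ {x′ y′} → Link G Y L x′ y′ → x ≡ x′ × y ≡ y′) →
                    ∀ d → d * s ≡ e G L + 1 → Good S
      bridge⇒good {x} {y} l@(x∈Y , y∈L , x~y) unique d d≡
        with D , y∈D , D⊆L , isoL , ≤L ← Step.through-vertex (λ T⊂L → ih (⊂-trans T⊂L (comp⊂ comp))) conn y∈L
           | D′ , D′⊆M , isoM , ≤M ← M-sol (Y⇒M x∈Y)
        = D ∪ D′ , (λ d∈ → [ L⊆S ∘ D⊆L , p─q⊆p S L ∘ D′⊆M ]′ (x∈p∪q⁻ D D′ d∈)) , isolates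
        , ≤-trans (∪-size D D′ (round-down d ∣ D ∣ ≤L d≡) ≤M)
                  (bridge-bound (e+1≤cost G disj (link⇒M l)) eM+cost≤)
        where
        x-dominated : Dominated G (D ∪ D′) x
        x-dominated = y , p⊆p∪q D′ y∈D , inj₂ (~-sym x~y)
        isolates : Isolates Nowhere S (D ∪ D′)
        -- The only edge between `L` and `M` ends in `x`, which `y` dominates, so no surviving copy
        -- crosses it.
        isolates cp with copy-split (_∈ L) (_∈ M) cp (S-cover ∘ proj₁)
          (λ (_ , _ , _) (_ , _ , ¬Dv) u∈L v∈M u~v →
            ¬Dv (subst (Dominated G (D ∪ D′)) (proj₁ (unique (M-L-link v∈M u∈L (~-sym u~v)))) x-dominated))
        ... | inj₁ cpL = isoL (copy-mono (λ
                ((_ , ¬∅ , ¬D) , u∈L) → u∈L , ¬∅ , ¬D ∘ dominated-mono (p⊆p∪q D′)) cpL)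
        ... | inj₂ cpM = isoM (copy-mono (λ ((_ , ¬∅ , ¬D) , u∈M) →
                u∈M , (λ { refl → ¬D x-dominated }) , ¬D ∘ dominated-mono (q⊆p∪q D D′)) cpM)

      -- A second link, or a set strictly below the bound, gives the spare edge. What is left is a
      -- bridge with `s` dividing e(L) + 1.
      good-component : Good L → Good S
      good-component good@(D , D⊆L , iso , ≤L)
        with x , y , l ← link comp
        with any? (λ x′ → any? (λ y′ → link? G Y L x′ y′ ×-dec ¬? ((x ≟ x′) ×-dec (y ≟ y′))))
      ... | yes (x′ , y′ , l′ , ≢) = spare⇒good k≤eY comp (sol-mono (λ ()) ≤-refl good)
              (≤-trans (≤-reflexive (+-assoc (e G L) 1 1)) (e+2≤cost G (comp-disjoint comp) l l′ ≢))
      ... | no ¬other with m≤n⇒m<n∨m≡n ≤L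
      ...   | inj₁ <L = spare⇒good k≤eY comp
                (sol-mono {X = Nowhere} (λ ()) ≤-refl
                  (D , D⊆L , iso , s≤s⁻¹ (≤-trans <L (≤-reflexive (+-comm (e G L) 1)))))
                (e+1≤cost G (comp-disjoint comp) l)
      ...   | inj₂ ≡L = bridge⇒good l (λ {x′} {y′} l′ →
                decidable-stable ((x ≟ x′) ×-dec (y ≟ y′)) (λ ≢ → ¬other (x′ , y′ , l′ , ≢))) ∣ D ∣ ≡L

      -- A centre of the copy dominates all of `L`, and the e(L) + 2 edges with an end in `L` pay
      -- for it, which settles a good `M`. For a special `M` both sides are copies of `F`, or `M` is
      -- a 6-cycle with an edge attached.
      two-links : ∀ {x₁ y₁ x₂ y₂} → F ≅ induced G L → Link G Y L x₁ y₁ → Link G Y L x₂ y₂ → x₂ ≢ x₁ →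
        (∀ {x y} → Link G Y L x y → (x ≡ x₁ × y ≡ y₁) ⊎ (x ≡ x₂ × y ≡ y₂)) → Good S ⊎ Bad S
      two-links {x₁} {y₁} {x₂} {y₂} F≅L l₁@(x₁∈Y , y₁∈L , x₁~y₁) l₂@(x₂∈Y , y₂∈L , x₂~y₂) x₂≢x₁ only
        with ih M⊂S M-conn
      ... | inj₁ good with c , c∈L , cp ← centre (≅⇒copy-in F≅L) =
              inj₁ (sol-mono id (copy-bound k≤eL e+2≤ eM+cost≤)
                (hubSol⇒sol (add-hub (L⊆S c∈L) (p─q⊆p S L)
                  (λ u∈S → Sum.map₁ (λ u∈L → proj₂ (copy-spans conn (≅⇒e≤k F≅L) cp proj₁ u∈L)) (S-cover u∈S))
                  (sol-mono (λ ()) ≤-refl good))))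
              where
              k≤eL = k≤e (≅⇒copy-in F≅L)
              e+2≤ = e+2≤cost G disj (link⇒M l₁) (link⇒M l₂) (x₂≢x₁ ∘ sym ∘ proj₁)
      ... | inj₂ (inj₂ (P₃≅F , C₆≅M)) = inj₁ (C₆-attached⇒good P₃≅F C₆≅M (p─q⊆p S L) (L⊆S y₁∈L)
              (λ y₁∈M → disj y₁∈M y₁∈L) (Y⇒M x₁∈Y) (~-sym x₁~y₁))
      ... | inj₂ (inj₁ F≅M) with y₁ ≟ y₂
      -- With `y₁` and `y₂` equal, all edges leaving `M` end in that vertex, so `M` is a special
      -- component once it is deleted.
      ...   | yes refl = inj₁ (bad-component⇒good (L⊆S y₁∈L) M-comp (inj₁ F≅M))
              where
              M-comp : Component G (S ─ ⁅ y₁ ⁆) M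
              M-comp = record
                { L⊆R = λ u∈M → x∈p∧x∉q⇒x∈p─q (p─q⊆p S L u∈M)
                    (λ u∈y → disj u∈M (subst (_∈ L) (sym (x∈⁅y⁆⇒x≡y y₁ u∈y)) y₁∈L))
                ; conn = M-conn
                ; closed = λ {u} {w} u∈M w∈ u~w → x∈p∧x∉q⇒x∈p─q (p─q⊆p S ⁅ y₁ ⁆ w∈) λ w∈L →
                    ∈─⇒∉ S ⁅ y₁ ⁆ w∈ (subst (_∈ ⁅ y₁ ⁆)
                      (sym ([ proj₂ , proj₂ ]′ (only (M-L-link u∈M w∈L u~w)))) (x∈⁅x⁆ y₁))
                }
      ...   | no y₁≢y₂ = twoJoined⇒good⊎bad (record
              { M⊆S = p─q⊆p S L ; L⊆S = L⊆S ; cover = Sum.swap ∘ S-cover ; disj = disj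
              ; M-conn = M-conn ; L-conn = conn ; eM≤k = ≅⇒e≤k F≅M ; eL≤k = ≅⇒e≤k F≅L
              ; x₁∈M = Y⇒M x₁∈Y ; x₂∈M = Y⇒M x₂∈Y ; y₁∈L = y₁∈L ; y₂∈L = y₂∈L
              ; x₁~y₁ = x₁~y₁ ; x₂~y₂ = x₂~y₂ ; x₁≢x₂ = x₂≢x₁ ∘ sym ; y₁≢y₂ = y₁≢y₂
              ; cross = λ x∈M y∈L x~y → only (M-L-link x∈M y∈L x~y) }) F≅L
              (m+n≤o⇒m≤o s (copy-bound (k≤e (≅⇒copy-in F≅L))
                (e+2≤cost G disj (link⇒M l₁) (link⇒M l₂) (x₂≢x₁ ∘ sym ∘ proj₁)) eM+cost≤))

      -- A third link is the spare edge on top of e(L) + 2. With exactly two links, a 6-cycle yields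
      -- a vertex of degree 3, and a copy of `F` is left to `two-links`.
      bad-component : Bad L → Good S ⊎ Bad S
      bad-component bad with x₁ , y₁ , l₁ ← link comp with second-link comp bad l₁
      ... | inj₁ done = inj₁ done
      ... | inj₂ (x₂ , y₂ , l₂ , x₂≢x₁)
        with any? (λ x → any? (λ y → link? G Y L x y
               ×-dec ¬? ((x ≟ x₁) ×-dec (y ≟ y₁)) ×-dec ¬? ((x ≟ x₂) ×-dec (y ≟ y₂))))
      ...   | yes (x₃ , y₃ , l₃ , ≢₁ , ≢₂) = inj₁ (spare⇒good k≤eY comp (bad-sol conn bad)
                (≤-trans (≤-reflexive (+-assoc (e G L) 2 1)) (e+3≤cost G (comp-disjoint comp) l₁ l₂ l₃
                  (x₂≢x₁ ∘ sym ∘ proj₁) (λ (p , q) → ≢₁ (sym p , sym q)) (λ (p , q) → ≢₂ (sym p , sym q)))))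
      ...   | no ¬third with bad
      ...     | inj₂ (P₃≅F , C₆≅L) with x₁∈Y , y₁∈L , x₁~y₁ ← l₁ = inj₁ (C₆-attached⇒good P₃≅F C₆≅L L⊆S
                  (Y⊆S x₁∈Y) (comp-disjoint comp x₁∈Y) y₁∈L x₁~y₁)
      ...     | inj₁ F≅L = two-links F≅L l₁ l₂ x₂≢x₁ λ {x} {y} l →
                  decidable-stable (((x ≟ x₁) ×-dec (y ≟ y₁)) ⊎-dec ((x ≟ x₂) ×-dec (y ≟ y₂)))
                    (λ ≢ → ¬third (x , y , l , ≢ ∘ inj₁ , ≢ ∘ inj₂))

    -- If the closed neighbourhood of `v` is all of `S` and not heavy, the copy exhausts G[S].
    -- Otherwise any single component decides.
    remainder : FCopy (λ u → u ∈ S × Near G v u) → Good S ⊎ Bad S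
    remainder cp with k + 1 ≤? e G Y
    ... | yes heavy = inj₁ (heavy⇒good heavy)
    ... | no ¬heavy with nonempty? (S ─ Y)
    ...   | no R≡∅ = inj₂ (inj₁ (tight-copy⇒≅ S-conn eS≤k (copy-mono proj₁ cp)))
      where
      S⊆Y : S ⊆ Y
      S⊆Y {u} u∈S = decidable-stable (u ∈? Y) λ u∉Y → R≡∅ (u , x∈p∧x∉q⇒x∈p─q u∈S u∉Y)
      eS≤k : e G S ≤ k
      eS≤k = ≤-trans (count-mono (inducedEdge? G S) (inducedEdge? G Y) (map₂ λ (u∈ , v∈) → S⊆Y u∈ , S⊆Y v∈))
                     (s≤s⁻¹ (≤-trans (≰⇒> ¬heavy) (≤-reflexive (+-comm k 1))))
    ...   | yes (z , z∈R) with L , z∈L , comp ← component G z∈R with ih (comp⊂ comp) (Component.conn comp)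
    ...     | inj₁ good = inj₁ (good-component (k≤e (copy-mono (λ (u∈ , near) → ∈Y u∈ near) cp)) comp good)
    ...     | inj₂ bad  = bad-component (k≤e (copy-mono (λ (u∈ , near) → ∈Y u∈ near) cp)) comp bad

  good⊎bad : ∀ {S} → Conn G S → Good S ⊎ Bad S
  good⊎bad {S} = go (<-wellFounded ∣ S ∣)
    where
    go : ∀ {S} → Acc ℕ._<_ ∣ S ∣ → Conn G S → Good S ⊎ Bad S
    go {S} (acc rec) S-conn with copy? {A = F} {G = G} (_∈? S)
    ... | no ¬cp = inj₁ (sol-mono id z≤n (sol-∅ (¬cp ∘ copy-mono proj₁)))
    ... | yes cp with v , v∈S , cp′ ← centre cp =
      Remainder.remainder (λ T⊂S → go (rec (p⊂q⇒∣p∣<∣q∣ T⊂S))) S-conn v∈S cp′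

-- Translation to the given definitions

∣p∣≡1⇒≡ : ∀ {n} {p : Subset n} {x y} → ∣ p ∣ ≡ 1 → x ∈ p → y ∈ p → y ≡ x
∣p∣≡1⇒≡ {p = p} {x} {y} ∣p∣≡1 x∈p y∈p = decidable-stable (y ≟ x) λ y≢x →
  contradiction (≤-trans (s≤s (≤-trans (≤-reflexive (sym (∣⁅x⁆∣≡1 y)))
    (p⊆q⇒∣p∣≤∣q∣ (⁅x⁆⊆ (x∈p∧x≢y⇒x∈p-y y∈p y≢x)))))
    (≤-trans (x∈p⇒∣p-x∣<∣p∣ x∈p) (≤-reflexive ∣p∣≡1))) λ { (s≤s ()) }

universal-vertex : ∀ {a} {F : Graph a} → DominationNumber F 1 →
                   ∃ λ c → c ∈ V F × (∀ {i} → i ∈ V F → Near F c i)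
universal-vertex {a} {F} ((D , (D⊆V , N≡V) , ∣D∣≡1) , _) with nonempty? D
... | no empty = contradiction (trans (sym ∣D∣≡1) (trans (cong ∣_∣ (Empty-unique empty)) (∣⊥∣≡0 a))) λ ()
... | yes (c , c∈D) = c , D⊆V c∈D , λ {i} i∈V →
  let (d , d∈D , near) = ∈closedNbhdSet⁻ F (subst (i ∈_) (sym N≡V) i∈V) in
  subst (λ c → Near F c i) (∣p∣≡1⇒≡ ∣D∣≡1 c∈D d∈D) near

-- A walk from inside `T` to a vertex outside has a first step that leaves `T`.
connected⇒conn : ∀ {n} {G : Graph n} → Connected G → Conn G (V G)
connected⇒conn {G = G} (V≠∅ , walks) = record
  { nonempty = V≠∅
  ; boundary = λ { T T⊆V (t , t∈T) {z} z∈V z∉T → crossing T (walks t z (T⊆V t∈T) z∈V) t∈T z∉T } }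
  where
  open Graph G using (_~_; ~-sym; ~⇒∈V)
  crossing : ∀ T {t z} → Star _~_ t z → t ∈ T → z ∉ T → ∃₂ λ u v → u ∈ T × v ∈ V G × v ∉ T × u ~ v
  crossing T ε t∈T z∉T = contradiction t∈T z∉T
  crossing T {t} (_◅_ {j = w} t~w walk) t∈T z∉T with w ∈? T
  ... | yes w∈T = crossing T walk w∈T z∉T
  ... | no w∉T  = t , w , t∈T , ~⇒∈V (~-sym t~w) , w∉T , t~w

induced-V≅ : ∀ {n} (G : Graph n) → induced G (V G) ≅ G
induced-V≅ G = copy⇒≅ (record { f = id ; f∈ = id ; f-inj = λ _ _ → id ; f~ = proj₁ })
  (λ z∈ → _ , z∈ , refl) (λ u∈ v∈ u~v → u~v , u∈ , v∈)

-- The isolation number is a relation, so a value has to be produced: descend from a given set as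
-- long as a smaller one exists.
minimum : ∀ {n} {ℓ : Level} {P : Subset n → Set ℓ} → U.Decidable P → ∃ P → ∃ (IsMinimumSize P)
minimum {P = P} P? (D , PD) = go D PD (<-wellFounded ∣ D ∣)
  where
  go : ∀ D → P D → Acc ℕ._<_ ∣ D ∣ → ∃ (IsMinimumSize P)
  go D PD (acc rec) with anySubset? (λ D′ → P? D′ ×-dec (∣ D′ ∣ ℕ.<? ∣ D ∣))
  ... | yes (D′ , PD′ , <D) = go D′ PD′ (rec <D)
  ... | no ¬smaller = ∣ D ∣ , (D , PD , refl) , λ D′ PD′ → ≮⇒≥ λ <D → ¬smaller (D′ , PD′ , <D)

injection⇒≤∣p∣ : ∀ {n} q {p : Subset n} (f : Fin q → Fin n) → (∀ i → f i ∈ p) →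
                 (∀ {i j} → f i ≡ f j → i ≡ j) → q ≤ ∣ p ∣
injection⇒≤∣p∣ zero f f∈ f-inj = z≤n
injection⇒≤∣p∣ (suc q) {p} f f∈ f-inj = ≤-trans
  (s≤s (injection⇒≤∣p∣ q {p - f zero} (f ∘ suc)
    (λ i → x∈p∧x≢y⇒x∈p-y (f∈ (suc i)) (λ eq → contradiction (f-inj {suc i} {zero} eq) λ ()))
    (Fin.suc-injective ∘ f-inj)))
  (x∈p⇒∣p-x∣<∣p∣ (f∈ zero))

module _ {a n : ℕ} {F : Graph a} (x₀ : Vertex F) (G : Graph n) where

  contains-delete⇒copy : ∀ {D} → Contains (delete G (closedNbhdSet G D)) F →
                         Copy F G (λ u → u ∈ V G × ¬ Dominated G D u)
  contains-delete⇒copy {D} cont = record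
    { f = f ; f-inj = f-inj ; f~ = proj₁ ∘ f~
    ; f∈ = λ i∈ → map₂ (_∘ ∈closedNbhdSet⁺ G) (∈─⁻ (V G) (closedNbhdSet G D) (f∈ i∈)) }
    where open Copy (contains⇒copy x₀ cont)

  copy⇒contains-delete : ∀ {D} → Copy F G (λ u → u ∈ V G × ¬ Dominated G D u) →
                         Contains (delete G (closedNbhdSet G D)) F
  copy⇒contains-delete {D} cp = copy⇒contains record
    { f = f ; f-inj = f-inj
    ; f∈ = λ i∈ → x∈p∧x∉q⇒x∈p─q (proj₁ (f∈ i∈)) (undominated i∈)
    ; f~ = λ i~j → f~ i~j , undominated (Graph.~⇒∈V F i~j) , undominated (Graph.~⇒∈V F (Graph.~-sym F i~j)) }
    where
    open Copy cp
    undominated : ∀ {i} → i ∈ V F → f i ∉ closedNbhdSet G D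
    undominated i∈ = proj₂ (f∈ i∈) ∘ ∈closedNbhdSet⁻ G

  isolating? : U.Decidable (Isolating G F)
  isolating? D = (D ⊆? V G) ×-dec ¬? (map′ (copy⇒contains-delete {D}) (contains-delete⇒copy {D})
    (copy? λ u → (u ∈? V G) ×-dec ¬? (dominated? G D u)))

-- Each of the disjoint sets V(Gᵢ) must meet an isolating set D: the neighbours of Fᵢ lie in V(Gᵢ).
assembled⇒≤∣D∣ : ∀ {a n} {F₀ : Graph a} {p r} {G₀ : Graph n} → Assembled F₀ p r G₀ →
                 ∀ {D} → Isolating G₀ F₀ D → suc p ≤ ∣ D ∣
assembled⇒≤∣D∣ {F₀ = F₀} {p} {r} {G₀} asm {D} (_ , ¬contains) =
  injection⇒≤∣p∣ (suc p) (proj₁ ∘ meets) (proj₁ ∘ proj₂ ∘ meets)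
    λ {i} {j} eq → unique i j (proj₂ (proj₂ (meets i)))
                              (subst (_∈ V (G j)) (sym eq) (proj₂ (proj₂ (meets j))))
  where
  open Assembled asm
  open Equivalence using () renaming (to to ⇒; from to ⇐)
  unique : ∀ i j {x} → x ∈ V (G i) → x ∈ V (G j) → i ≡ j
  unique i j {x} x∈i x∈j with i ≟ j
  ... | yes i≡j = i≡j
  ... | no i≢j with ⇒ (V-G i x) x∈i | ⇒ (V-G j x) x∈j
  ...   | inj₁ refl | inj₁ eq   = v-injective eq
  ...   | inj₁ refl | inj₂ v∈F  = contradiction v∈F (v∉F i j)
  ...   | inj₂ x∈F  | inj₁ refl = contradiction x∈F (v∉F j i)
  ...   | inj₂ x∈Fᵢ | inj₂ x∈Fⱼ = contradiction x∈Fⱼ (F-disjoint i j i≢j x x∈Fᵢ)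

  F⊆G : ∀ i {x} → x ∈ V (F i) → x ∈ V (G i)
  F⊆G i x∈ = ⇐ (V-G i _) (inj₂ x∈)

  -- Edges of `T` join only vertices `v j`, and `T′` meets the sets V(Gⱼ) only in the last of these;
  -- neither kind of edge has an end in `F i`.
  neighbours : ∀ i {x d} → x ∈ V (F i) → Graph._~_ G₀ x d → d ∈ V (G i)
  neighbours i {x} {d} x∈ x~d with ⇒ (E-G₀ x d) x~d
  ... | inj₁ x~ᵀd with j , refl ← ⇒ (V-T x) (Graph.~⇒∈V T x~ᵀd) = contradiction x∈ (v∉F j i)
  ... | inj₂ (inj₁ x~d′) with refl ← ⇒ (V-T′∩V-G x) (Graph.~⇒∈V T′ x~d′ , i , F⊆G i x∈) =
    contradiction x∈ (v∉F (fromℕ p) i)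
  ... | inj₂ (inj₂ (j , x~ʲd))
    with refl ← unique i j (F⊆G i x∈) (Graph.~⇒∈V (G j) x~ʲd) = Graph.~⇒∈V (G i) (Graph.~-sym (G i) x~ʲd)

  meets : ∀ i → ∃ λ d → d ∈ D × d ∈ V (G i)
  meets i with any? (λ d → (d ∈? D) ×-dec (d ∈? V (G i)))
  ... | yes meet = meet
  ... | no ¬meet = contradiction (F i , record { V⊆ = V⊆ ; ~⊆ = ~⊆ } , F-copy i) ¬contains
    where
    undominated : ∀ {x} → x ∈ V (F i) → x ∉ closedNbhdSet G₀ D
    undominated x∈ x∈N with ∈closedNbhdSet⁻ G₀ x∈N
    ... | d , d∈D , inj₁ refl = ¬meet (d , d∈D , F⊆G i x∈)
    ... | d , d∈D , inj₂ d~x  = ¬meet (d , d∈D , neighbours i x∈ (Graph.~-sym G₀ d~x))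
    V⊆ : V (F i) ⊆ V G₀ ─ closedNbhdSet G₀ D
    V⊆ x∈ = x∈p∧x∉q⇒x∈p─q (⇐ (V-G₀ _) (inj₂ (i , F⊆G i x∈))) (undominated x∈)
    ~⊆ : ∀ {x y} → Graph._~_ (F i) x y → Graph._~_ (delete G₀ (closedNbhdSet G₀ D)) x y
    ~⊆ {x} {y} x~y = ⇐ (E-G₀ x y) (inj₂ (inj₂ (i , ⇐ (E-G i x y) (inj₂ (inj₂ x~y)))))
      , undominated (Graph.~⇒∈V (F i) x~y) , undominated (Graph.~⇒∈V (F i) (Graph.~-sym (F i) x~y))

-- Quotients and the conclusion

≤-quotient : ∀ {d s N} → d * suc s ≤ N → d ≤ N / suc s
≤-quotient {d} {s} d*s≤N = ≤-trans (≤-reflexive (sym (m*n/n≡m d (suc s)))) (/-monoˡ-≤ (suc s) d*s≤N)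

-- `r ≤ k + 1` puts the remainder strictly below `k + 2`, so it adds nothing to the quotient.
quotient≤ : ∀ {N q k r} → N ≡ q * (k + 2) + r → r ≤ k + 1 → N / (2 + k) ≤ q
quotient≤ {N} {q} {k} {r} refl r≤ = s≤s⁻¹ (m<n*o⇒m/o<n {N} {suc q} {2 + k} (begin-strict
  q * (k + 2) + r        <⟨ +-monoʳ-< (q * (k + 2)) (≤-trans (s≤s r≤) (≤-reflexive (cong suc (+-comm k 1)))) ⟩
  q * (k + 2) + (2 + k)  ≡⟨ cong (λ t → q * t + (2 + k)) (+-comm k 2) ⟩
  q * (2 + k) + (2 + k)  ≡⟨ +-comm (q * (2 + k)) (2 + k) ⟩
  suc q * (2 + k)        ∎))
  where open ≤-Reasoning

special⇒quotient≤ : ∀ {a n m ι} {F : Graph a} {G : Graph n} → SpecialGraph m F G → IsolationNumber G F ι →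
                    (m + 1) / (2 + size F) ≤ ι
special⇒quotient≤ (q≡0 m+1≡ r≤ _ _) _ = ≤-trans (quotient≤ {q = 0} m+1≡ r≤) z≤n
special⇒quotient≤ (q≥1 {p = p} m+1≡ r≤ asm) ((D , isolating , refl) , _) =
  ≤-trans (quotient≤ {q = suc p} m+1≡ r≤) (assembled⇒≤∣D∣ asm isolating)

theorem1p2 : ∀ {a n} (k m : ℕ) (F : Graph a) (G : Graph n) →
    size F ≡ k → DominationNumber F 1 →
    Connected G → size G ≡ m →
    ¬ SpecialPair G F →
    ∃[ ι ] IsolationNumber G F ι
    × ι ≤ (m + 1) / (2 + k)
    × (SpecialGraph m F G → ι ≡ (m + 1) / (2 + k))
theorem1p2 _ _ F G refl dominated connected refl ¬special
  with c , c∈F , c-universal ← universal-vertex {F = F} dominated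
  with Isolation.good⊎bad F G c∈F c-universal (connected⇒conn connected)
... | inj₂ (inj₁ F≅G) = contradiction (inj₁ (≅-trans F≅G (induced-V≅ G))) ¬special
... | inj₂ (inj₂ (P₃≅F , C₆≅G)) = contradiction (inj₂ (P₃≅F , ≅-trans C₆≅G (induced-V≅ G))) ¬special
... | inj₁ (D , D⊆V , iso , D≤) = ι , ι-min , ι≤ , λ special → ≤-antisym ι≤ (special⇒quotient≤ special ι-min)
  where
  isolating : Isolating G F D
  isolating = D⊆V , λ contains → iso (copy-mono (λ (u∈ , ¬D) → u∈ , (λ ()) , ¬D)
    (contains-delete⇒copy (c , c∈F) G {D} contains))
  least : ∃ (IsolationNumber G F)
  least = minimum (isolating? (c , c∈F) G) (D , isolating)
  ι : ℕ
  ι = proj₁ least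
  ι-min : IsolationNumber G F ι
  ι-min = proj₂ least
  ι≤ : ι ≤ (size G + 1) / (2 + size F)
  -- The bound is in terms of e(V(G)); edges induced on V(G) are edges of `G`, so it passes to
  -- `size G`.
  ι≤ = ≤-trans (proj₂ ι-min D isolating) (≤-quotient (≤-trans D≤
    (+-monoˡ-≤ 1 (count-mono (inducedEdge? G (V G)) (Graph._~?_ G) proj₁))))
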